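{- Let $\mathcal{C}$ be the set of computable functions $f:\mathbf{N}\to\mathbf{N}$ for which an asymptotically optimal Turing machine $M^*_f$ and an efficient E-Turing machine $M_f^{eff}$ exist, and such that every E-Turing machine $M_f$ for $f$ satisfies $T(M_f(n))=\Omega(n\log n)$. Then computational analogy $\mathbf{CA}$ is an equivalence relation on $\mathcal{C}$.
   Context: Computational model. Turing machines have $k\ge 2$ tapes and symbols $0,1,\#$; natural numbers are written with $0,1$. The output tape is one-way (its head may only move right). Intermediate results are successively written on the output tape, each with the symbol $\#$ at its left; the final result is what stands at the right of the last $\#$ when the machine halts. $T(M(n))$ is the number of steps of $M$ on input $n$ before halting. For a machine $M$ on input $n$, $R_{n,j}$ denotes the content of the output tape after $j$ steps. Values $f(n)$ are considered for $n\ge 1$. Asymptotic notation. $a(n)=O(b(n))$: there are $c>0,n_0>0$ with $|a(n)|\le c|b(n)|$ for all $n>n_0$. $a(n)=\Omega(b(n))$: there are $c>0,n_0>0$ with $|a(n)|\ge c|b(n)|$ for all $n>n_0$. E-Turing machine. A Turing machine $M_f$ is a E-Turing machine for $f$ if (i) on every input $n$ it computes $f(n)$ and halts; (ii) during the computation on input $n$ there exist increasing step indices $k_n(i)$, $i=1,\dots,n-1$, such that $f(i)$ is written on the output tape $R_{n,k_n(i)}$ at the right of the last symbol $\#$. Optimal machines. An asymptotically optimal Turing machine $M^*_f$ for $f$ is a Turing machine computing $f$ such that $T(M^*_f(n))=O(T(M(n)))$ for every Turing machine $M$ computing $f$. An efficient E-Turing machine $M_f^{eff}$ for $f$ is a E-Turing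 machine for $f$ such that $T(M_f^{eff}(n))=O(T(M_f(n)))$ for every E-Turing machine $M_f$ for $f$. Approximation. A Turing machine $M$ is a $P$-approximation of a E-Turing machine for $f$ (or simply an approximation, when some such $P$ exists) if there are a function $F$ with $F(n)=O(T(M^*_f(n))/n)$ and a Turing machine $P$ such that for every $n$: (i) on input $n$, $M$ computes a result $r_n$ such that $P$ computes $f(n)$ from $n$ and $r_n$ in $F(n)$ steps and halts; (ii) during the computation of $M$ on input $n$ there exist non-decreasing $k_n(i)$, $i=1,\dots,n-1$, such that a result $r'_{n,i}$ is written on the output tape $R_{n,k_n(i)}$ at the right of the last symbol $\#$ and $P$ computes $f(i)$ from $n$, $i$ and $r'_{n,i}$ in $F(i)$ steps and halts. (With $r_n=r'_{n,n}$, $P$ always computes from the triple $(n,i,r'_{n,i})$.) Computational analogy. $f$ and $g$ are computationally analog, written $f\ \mathbf{CA}\ g$, if (i) there exists a Turing machine $M$ that is both a E-Turing machine for $f$ and an approximation of a E-Turing machine for $g$, and (ii) there exists a Turing machine $M'$ that is both a E-Turing machine for $g$ and an approximation of a E-Turing machine for $f$. -}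

module Defs where

open import Data.Bool using (Bool; true; false)
open import Data.Digit using (Digit; toDigits)
open import Data.Fin using (Fin; zero; suc)
open import Data.Integer using (+_)
open import Data.List using (List; []; _∷_; _++_; map; reverse; replicate)
open import Data.Nat using (ℕ; suc; _+_; _*_; _≤_; _<_; _>_; NonZero)
open import Data.Nat.GeneralisedArithmetic using (iterate)
open import Data.Nat.Logarithm using (⌊log₂_⌋)
open import Data.Product using (Σ; Σ-syntax; ∃; ∃-syntax; _×_; _,_; proj₁; proj₂)
open import Data.Rational.Unnormalised as ℚ using (ℚᵘ; 0ℚᵘ; _/_; ∣_∣)
open import Data.Vec as Vec using (Vec)
open import Function using (_↔_)
open import Relation.Binary.PropositionalEquality using (_≡_)

------------------------------------------------------------------------
-- Tapes

-- □ is the empty cell.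
data Symbol : Set where
  𝟎 𝟏 ♯ □ : Symbol

data Move : Set where
  left stay right : Move

data OneWayMove : Set where
  stay right : OneWayMove

toMove : OneWayMove → Move
toMove stay  = stay
toMove right = right

-- A two-way infinite tape.  `before` lists the cells to the left of the
-- head, nearest first, and `after` those to its right, nearest first;
-- all the cells not listed are empty.
record Tape : Set where
  constructor tape
  field
    before : List Symbol
    head   : Symbol
    after  : List Symbol

open Tape public

moveHead : Move → Tape → Tape
moveHead left  (tape []      s rs)       = tape [] □ (s ∷ rs)
moveHead left  (tape (l ∷ ls) s rs)      = tape ls l (s ∷ rs)
moveHead stay  t                         = t
moveHead right (tape ls s [])            = tape (s ∷ ls) □ []
moveHead right (tape ls s (r ∷ rs))      = tape (s ∷ ls) r rs

act : Symbol × Move → Tape → Tape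
act (s , m) (tape ls _ rs) = moveHead m (tape ls s rs)

content : Tape → List Symbol
content (tape ls s rs) = reverse ls ++ s ∷ rs

blank : Tape
blank = tape [] □ []

digit : Digit 2 → Symbol
digit zero       = 𝟎
digit (suc zero) = 𝟏

-- Usual binary notation, most significant digit first, without leading
-- zeros; 0 is written 𝟎.
numeral : ℕ → List Symbol
numeral n = map digit (reverse (proj₁ (toDigits 2 n)))

-- Since numerals contain no ♯, the ♯ displayed is the last one.
record _Shows_ (t : Tape) (y : ℕ) : Set where
  field
    earlier : List Symbol
    empty   : ℕ
    shows   : content t ≡ earlier ++ ♯ ∷ numeral y ++ replicate empty □

-- The head stands on the leftmost digit.
inputTape : ℕ → Tape
inputTape n with numeral n
... | []     = blank
... | s ∷ ss = tape [] s ss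

-- ♯ and the numeral of r, with the head on the first empty cell at the
-- right, as when a machine has just written the result r.
resultTape : ℕ → Tape
resultTape r = tape (reverse (♯ ∷ numeral r)) □ []

------------------------------------------------------------------------
-- Turing machines

-- A machine with m input tapes (which it may also write on), `work`
-- further tapes and a one-way output tape.  In particular `Machine 1`
-- comprises the machines with one input and k = work + 2 ≥ 2 tapes.
record Machine (m : ℕ) : Set₁ where
  field
    work    : ℕ
    State   : Set
    size    : ℕ
    finite  : State ↔ Fin size
    start   : State
    halting : State → Bool
    δ       : State → Vec Symbol (m + work) → Symbol →
              State × Vec (Symbol × Move) (m + work) × (Symbol × OneWayMove)

module _ {m : ℕ} (M : Machine m) where
  open Machine M

  record Config : Set where
    constructor config
    field
      state  : State
      tapes  : Vec Tape (m + work)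
      output : Tape

  open Config public

  step : Config → Config
  step (config q ts o) with δ q (Vec.map head ts) (head o)
  ... | q′ , as , (s , d) = config q′ (Vec.zipWith act as ts) (act (s , toMove d) o)

  initial : Vec ℕ m → Tape → Config
  initial xs o = config start (Vec.map inputTape xs Vec.++ Vec.replicate work blank) o

  HaltsAfter : ℕ → Config → Set
  HaltsAfter t c =
    halting (state (iterate step c t)) ≡ true ×
    (∀ s → s < t → halting (state (iterate step c s)) ≡ false)

_on_ : (M : Machine 1) → ℕ → Config M
M on n = initial M (n Vec.∷ Vec.[]) blank

-- The output tape of M on input n after j steps.
R : (M : Machine 1) → ℕ → ℕ → Tape
R M n j = output (iterate (step M) (M on n) j)

record _Computes_ (M : Machine 1) (f : ℕ → ℕ) : Set where
  field
    time   : (n : ℕ) → .{{NonZero n}} → ℕ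
    halts  : ∀ n → .{{_ : NonZero n}} → HaltsAfter M (time n) (M on n)
    result : ∀ n → .{{_ : NonZero n}} → R M n (time n) Shows f n

open _Computes_ public using (time)

-- P computes y from n, i and r in at most b steps.  The three numbers
-- are on separate input tapes, and P goes on writing at the right of ♯r
-- on the output tape: r is the current result, and remains the result
-- if P writes nothing.  So turning r into r takes no step, as it must
-- when the bound b, of order T(M*(n))/n, is smaller than the length of r.
_Turns_To_Within_ : Machine 3 → ℕ × ℕ × ℕ → ℕ → ℕ → Set
P Turns (n , i , r) To y Within b =
  Σ[ t ∈ ℕ ] t ≤ b × HaltsAfter P t c × output (iterate (step P) c t) Shows y
  where
  c : Config P
  c = initial P (n Vec.∷ i Vec.∷ r Vec.∷ Vec.[]) (resultTape r)

------------------------------------------------------------------------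
-- Asymptotic notation

Seq : Set
Seq = (n : ℕ) → .{{NonZero n}} → ℚᵘ

fromℕ : ℕ → ℚᵘ
fromℕ k = + k / 1

_=O_ : Seq → Seq → Set
a =O b = Σ[ c ∈ ℚᵘ ] c ℚ.> 0ℚᵘ × Σ[ n₀ ∈ ℕ ] n₀ > 0 ×
  (∀ n → .{{_ : NonZero n}} → n > n₀ → ∣ a n ∣ ℚ.≤ c ℚ.* ∣ b n ∣)

_=Ω_ : Seq → Seq → Set
a =Ω b = Σ[ c ∈ ℚᵘ ] c ℚ.> 0ℚᵘ × Σ[ n₀ ∈ ℕ ] n₀ > 0 ×
  (∀ n → .{{_ : NonZero n}} → n > n₀ → ∣ a n ∣ ℚ.≥ c ℚ.* ∣ b n ∣)

T : ∀ {M f} → M Computes f → Seq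
T c n = fromℕ (time c n)

-- ½ log₂ n ≤ ⌊log₂ n⌋ ≤ log₂ n for n ≥ 2, so rounding does not affect Ω.
nlogn : Seq
nlogn n = fromℕ (n * ⌊log₂ n ⌋)

------------------------------------------------------------------------
-- E-Turing machines and optimality

record IsETuring (M : Machine 1) (f : ℕ → ℕ) : Set where
  field
    computes   : M Computes f
    k          : ℕ → ℕ → ℕ
    increasing : ∀ n → .{{NonZero n}} → ∀ i j → 1 ≤ i → i < j → j < n → k n i < k n j
    during     : ∀ n → .{{_ : NonZero n}} → ∀ i → 1 ≤ i → i < n → k n i ≤ time computes n
    written    : ∀ n → .{{NonZero n}} → ∀ i → 1 ≤ i → i < n → R M n (k n i) Shows f i

record IsOptimal (M* : Machine 1) (f : ℕ → ℕ) : Set₁ where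
  field
    computes : M* Computes f
    optimal  : ∀ M (c : M Computes f) → T computes =O T c

record IsEfficientETuring (Mᵉ : Machine 1) (f : ℕ → ℕ) : Set₁ where
  field
    isETuring : IsETuring Mᵉ f
    efficient : ∀ M (e : IsETuring M f) →
                T (IsETuring.computes isETuring) =O T (IsETuring.computes e)

------------------------------------------------------------------------
-- Approximation and computational analogy

record IsApproximationVia (P : Machine 3) (M : Machine 1) (f : ℕ → ℕ) : Set₁ where
  field
    M*            : Machine 1
    isOptimal     : IsOptimal M* f
    F             : ℕ → ℕ
    F-bound       : (λ n → fromℕ (F n)) =O
                    (λ n → + time (IsOptimal.computes isOptimal) n / n)
    r             : ℕ → ℕ
    computes      : M Computes r
    final         : ∀ n → .{{NonZero n}} → P Turns (n , n , r n) To f n Within F n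
    k             : ℕ → ℕ → ℕ
    r′            : ℕ → ℕ → ℕ
    nondecreasing : ∀ n → .{{NonZero n}} → ∀ i j → 1 ≤ i → i < j → j < n → k n i ≤ k n j
    during        : ∀ n → .{{_ : NonZero n}} → ∀ i → 1 ≤ i → i < n → k n i ≤ time computes n
    written       : ∀ n → .{{NonZero n}} → ∀ i → 1 ≤ i → i < n → R M n (k n i) Shows r′ n i
    intermediate  : ∀ n → .{{NonZero n}} → ∀ i → 1 ≤ i → i < n →
                    P Turns (n , i , r′ n i) To f i Within F i

IsApproximation : Machine 1 → (ℕ → ℕ) → Set₁
IsApproximation M f = ∃[ P ] IsApproximationVia P M f

_CA_ : (ℕ → ℕ) → (ℕ → ℕ) → Set₁
f CA g = (∃[ M ] IsETuring M f × IsApproximation M g) ×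
         (∃[ M ] IsETuring M g × IsApproximation M f)

Computable : (ℕ → ℕ) → Set₁
Computable f = ∃[ M ] M Computes f

record In𝒞 (f : ℕ → ℕ) : Set₁ where
  field
    computable : Computable f
    optimal    : ∃[ M* ] IsOptimal M* f
    efficient  : ∃[ Mᵉ ] IsEfficientETuring Mᵉ f
    slow       : ∀ M (e : IsETuring M f) → T (IsETuring.computes e) =Ω nlogn

𝒞 : Set₁
𝒞 = Σ (ℕ → ℕ) In𝒞

{-# OPTIONS --safe #-}
module Submission where

-- Only transitivity needs an argument.  Let M₁ be a E-Turing machine for f
-- that approximates g through P₁, and let P₃ turn the final results g i of
-- a E-Turing machine for g into h i, always from (i , i , g i).  Then M₁
-- itself approximates h, through P₁ followed by P₃ on (i , i , g i); its
-- intermediate results need not be changed.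
--
-- This takes F₁ i + F₃ i steps up to a constant, which is O(T(M*_h(i))/i)
-- if T(M*_g) = O(T(M*_h)).  For the latter, run M*_h and then the machine P₄
-- that turns h n into g n in F₄ n = O(T(M*_g(n))/n) steps: this computes g,
-- and F₄ n is absorbed by T(M*_g(n)).  Constants are absorbed since F ≥ 1,
-- unless P₃ or P₄ halts without a step, but then g = h.
--
-- The bounds may be smaller than the length of the numbers, so two machines
-- have to be run in sequence without copying or rereading their inputs.  The
-- inputs are therefore copied lazily: a cell is fetched from the input tape
-- when it is visited for the first time.

open import Defs
open import Data.Bool using (Bool; true; false; if_then_else_; not)
open import Data.Digit using (Digit; toDigits; fromDigits)
open import Data.Fin using (Fin; zero; suc)
open import Data.Fin.Patterns using (0F; 1F; 2F; 3F; 4F; 5F; 6F)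
open import Data.Fin.Properties as Fin using (+↔⊎; *↔×)
open import Data.Integer as ℤ using (+_)
import Data.Integer.Properties as ℤ
open import Data.List using (List; []; _∷_; _++_; map; reverse; replicate; length; _ʳ++_)
open import Data.List.Properties using (++-assoc; ++-identityʳ; length-++; map-injective; reverse-++; reverse-injective; reverse-involutive; unfold-reverse; length-ʳ++; ++-ʳ++)
open import Data.List.Relation.Unary.All as All using (All; []; _∷_)
open import Data.Maybe using (Maybe; just; nothing)
open import Data.Nat using (ℕ; zero; suc; _+_; _*_; _≤_; _<_; _>_; z≤n; s≤s; NonZero; >-nonZero)
open import Data.Nat.GeneralisedArithmetic using (iterate)
open import Data.Nat.ListAction using (sum)
open import Data.Nat.Properties
open import Data.Nat.Solver using (module +-*-Solver)
open import Data.Product using (∃-syntax; _×_; _,_; proj₁; proj₂)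
open import Data.Product.Function.NonDependent.Propositional using (_×-↔_)
import Data.Rational.Unnormalised as ℚ
import Data.Rational.Unnormalised.Properties as ℚ
open import Data.Sum using (_⊎_; inj₁; inj₂)
open import Data.Sum.Function.Propositional using (_⊎-↔_)
open import Data.Vec as Vec using (Vec; []; _∷_)
import Data.Vec.Properties as Vec
open import Function using (_∘_; id; _↔_; case_of_)
open import Function.Properties.Inverse using (↔-refl; ↔-sym; ↔-trans)
open import Relation.Binary using (IsEquivalence; tri<; tri≈; tri>)
open import Relation.Binary.PropositionalEquality using (_≡_; _≢_; refl; sym; trans; cong; cong₂; subst; subst₂; module ≡-Reasoning)
open import Relation.Nullary using (Dec; yes; no; contradiction)

-- Lists of symbols, tapes and results

-- P₃ is used at (i , i) even when M₁ runs on input n, because only final results can be identified: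
-- a machine that is a E-Turing machine for g and approximates h may show g i and its intermediate
-- result for i at different steps, but it halts with one result. The inputs have to be preserved
-- because P₁ may overwrite i, which P₃ still needs. A lazy copy leaves the source intact and moves
-- its head by at most one digit per step, so rewinding it costs no more than the run did, up to a
-- constant. Two further obstacles shape the construction. P₃ has i as two inputs and may read them
-- at unrelated speeds, whereas i stands on one tape. And P₁ may form g i by appending digits to r
-- on the output tape, which cannot be read back; the beginning of g i must then be read off the
-- input tape that holds r.

data IsDigit : Symbol → Set where
  𝟎 : IsDigit 𝟎
  𝟏 : IsDigit 𝟏

Digits : List Symbol → Set
Digits = All IsDigit

isBlank : Symbol → Bool
isBlank □ = true
isBlank _ = false

isBlank-digit : ∀ {s} → IsDigit s → isBlank s ≡ false
isBlank-digit 𝟎 = refl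
isBlank-digit 𝟏 = refl

digit-isDigit : ∀ d → IsDigit (digit d)
digit-isDigit 0F = 𝟎
digit-isDigit 1F = 𝟏

digit-injective : ∀ {d e} → digit d ≡ digit e → d ≡ e
digit-injective {0F} {0F} _  = refl
digit-injective {0F} {1F} ()
digit-injective {1F} {0F} ()
digit-injective {1F} {1F} _  = refl

map-digit-digits : ∀ ds → Digits (map digit ds)
map-digit-digits []       = []
map-digit-digits (d ∷ ds) = digit-isDigit d ∷ map-digit-digits ds

ʳ++-digits : ∀ {xs ys} → Digits xs → Digits ys → Digits (xs ʳ++ ys)
ʳ++-digits []       ys = ys
ʳ++-digits (x ∷ xs) ys = ʳ++-digits xs (x ∷ ys)

reverse-digits : ∀ {xs} → Digits xs → Digits (reverse xs)
reverse-digits xs = ʳ++-digits xs []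

numeral-digits : ∀ n → Digits (numeral n)
numeral-digits n = map-digit-digits (reverse (proj₁ (toDigits 2 n)))

bits : ℕ → List (Digit 2)
bits n = proj₁ (toDigits 2 n)

numeral≡⇒bits≡ : ∀ n ds → numeral n ≡ map digit (reverse ds) → bits n ≡ ds
numeral≡⇒bits≡ n ds eq =
  reverse-injective {x = bits n} {y = ds}
    (map-injective {f = digit} digit-injective {x = reverse (bits n)} {y = reverse ds} eq)

numeral-injective : ∀ m n → numeral m ≡ numeral n → m ≡ n
numeral-injective m n eq = begin
  m                   ≡⟨ sym (proj₂ (toDigits 2 m)) ⟩
  fromDigits (bits m) ≡⟨ cong fromDigits {x = bits m} {y = bits n} (numeral≡⇒bits≡ m (bits n) eq) ⟩
  fromDigits (bits n) ≡⟨ proj₂ (toDigits 2 n) ⟩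
  n                   ∎
  where open ≡-Reasoning

numeral-nonempty : ∀ n → numeral n ≢ []
numeral-nonempty zero    ()
numeral-nonempty (suc n) eq = 0≢1+n (begin
  0                         ≡⟨ cong fromDigits {x = []} {y = bits (suc n)} (sym (numeral≡⇒bits≡ (suc n) [] eq)) ⟩
  fromDigits (bits (suc n)) ≡⟨ proj₂ (toDigits 2 (suc n)) ⟩
  suc n                     ∎)
  where open ≡-Reasoning

hd : List Symbol → Symbol
hd []      = □
hd (x ∷ _) = x

tl : List Symbol → List Symbol
tl []       = []
tl (_ ∷ xs) = xs

inputTape-numeral : ∀ n → inputTape n ≡ tape [] (hd (numeral n)) (tl (numeral n))
inputTape-numeral n with numeral n
... | []    = refl
... | _ ∷ _ = refl

leftwards : Tape → List Symbol
leftwards t = head t ∷ before t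

-- On a content listed from right to left, `scan` finds the digits of the
-- result and `mark` is 𝟏 if there is a ♯.
scan : List Symbol → List Symbol
scan []       = []
scan (□ ∷ xs) = scan xs
scan (♯ ∷ xs) = []
scan (𝟎 ∷ xs) = 𝟎 ∷ scan xs
scan (𝟏 ∷ xs) = 𝟏 ∷ scan xs

scan-digits : ∀ xs → Digits (scan xs)
scan-digits []       = []
scan-digits (□ ∷ xs) = scan-digits xs
scan-digits (♯ ∷ xs) = []
scan-digits (𝟎 ∷ xs) = 𝟎 ∷ scan-digits xs
scan-digits (𝟏 ∷ xs) = 𝟏 ∷ scan-digits xs

length-scan : ∀ xs → length (scan xs) ≤ length xs
length-scan []       = z≤n
length-scan (□ ∷ xs) = m≤n⇒m≤1+n (length-scan xs)
length-scan (♯ ∷ xs) = z≤n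
length-scan (𝟎 ∷ xs) = s≤s (length-scan xs)
length-scan (𝟏 ∷ xs) = s≤s (length-scan xs)

mark : List Symbol → Symbol
mark []       = □
mark (♯ ∷ xs) = 𝟏
mark (𝟎 ∷ xs) = mark xs
mark (𝟏 ∷ xs) = mark xs
mark (□ ∷ xs) = mark xs

scan-digits++ : ∀ {ds} → Digits ds → ∀ xs → scan (ds ++ xs) ≡ ds ++ scan xs
scan-digits++ []       xs = refl
scan-digits++ (𝟎 ∷ ds) xs = cong (𝟎 ∷_) (scan-digits++ ds xs)
scan-digits++ (𝟏 ∷ ds) xs = cong (𝟏 ∷_) (scan-digits++ ds xs)

mark-digits++ : ∀ {ds} → Digits ds → ∀ xs → mark (ds ++ xs) ≡ mark xs
mark-digits++ []       xs = refl
mark-digits++ (𝟎 ∷ ds) xs = mark-digits++ ds xs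
mark-digits++ (𝟏 ∷ ds) xs = mark-digits++ ds xs

scan-blanks++ : ∀ k xs → scan (replicate k □ ++ xs) ≡ scan xs
scan-blanks++ zero    xs = refl
scan-blanks++ (suc k) xs = scan-blanks++ k xs

mark-blanks++ : ∀ k xs → mark (replicate k □ ++ xs) ≡ mark xs
mark-blanks++ zero    xs = refl
mark-blanks++ (suc k) xs = mark-blanks++ k xs

-- The scan stops at a ♯ inside `xs` and never reaches what follows.
scan-marked : ∀ xs ys zs → mark xs ≡ 𝟏 → scan (xs ++ ys) ≡ scan (xs ++ zs)
scan-marked (♯ ∷ xs) ys zs m = refl
scan-marked (𝟎 ∷ xs) ys zs m = cong (𝟎 ∷_) (scan-marked xs ys zs m)
scan-marked (𝟏 ∷ xs) ys zs m = cong (𝟏 ∷_) (scan-marked xs ys zs m)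
scan-marked (□ ∷ xs) ys zs m = scan-marked xs ys zs m

-- The ♯ on the right-hand side acts as a sentinel that ends the scan after `xs`. This splits a
-- result into the digits just written and those that stood on the output tape before.
scan-unmarked : ∀ xs ys → mark xs ≡ □ → scan (xs ++ ys) ≡ scan (xs ++ ♯ ∷ []) ++ scan ys
scan-unmarked []       ys m = refl
scan-unmarked (𝟎 ∷ xs) ys m = cong (𝟎 ∷_) (scan-unmarked xs ys m)
scan-unmarked (𝟏 ∷ xs) ys m = cong (𝟏 ∷_) (scan-unmarked xs ys m)
scan-unmarked (□ ∷ xs) ys m = scan-unmarked xs ys m

mark-cases : ∀ xs → mark xs ≡ 𝟏 ⊎ mark xs ≡ □
mark-cases []       = inj₂ refl
mark-cases (♯ ∷ xs) = inj₁ refl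
mark-cases (𝟎 ∷ xs) = mark-cases xs
mark-cases (𝟏 ∷ xs) = mark-cases xs
mark-cases (□ ∷ xs) = mark-cases xs

reverse-replicate : ∀ {A : Set} k (x : A) → reverse (replicate k x) ≡ replicate k x
reverse-replicate zero    x = refl
reverse-replicate (suc k) x =
  trans (unfold-reverse x (replicate k x))
    (trans (cong (_++ x ∷ []) (reverse-replicate k x)) (snoc k))
  where
  snoc : ∀ k → replicate k x ++ x ∷ [] ≡ x ∷ replicate k x
  snoc zero    = refl
  snoc (suc k) = cong (x ∷_) (snoc k)

reverse-shown : ∀ (es ds : List Symbol) k →
  reverse (es ++ ♯ ∷ ds ++ replicate k □) ≡ replicate k □ ++ reverse ds ++ ♯ ∷ reverse es
reverse-shown es ds k = begin
  reverse (es ++ ♯ ∷ ds ++ replicate k □)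
    ≡⟨ reverse-++ es _ ⟩
  reverse (♯ ∷ ds ++ replicate k □) ++ reverse es
    ≡⟨ cong (_++ reverse es) (unfold-reverse ♯ (ds ++ replicate k □)) ⟩
  (reverse (ds ++ replicate k □) ++ ♯ ∷ []) ++ reverse es
    ≡⟨ ++-assoc (reverse (ds ++ replicate k □)) (♯ ∷ []) (reverse es) ⟩
  reverse (ds ++ replicate k □) ++ ♯ ∷ reverse es
    ≡⟨ cong (_++ ♯ ∷ reverse es) (reverse-++ ds (replicate k □)) ⟩
  (reverse (replicate k □) ++ reverse ds) ++ ♯ ∷ reverse es
    ≡⟨ ++-assoc (reverse (replicate k □)) (reverse ds) (♯ ∷ reverse es) ⟩
  reverse (replicate k □) ++ reverse ds ++ ♯ ∷ reverse es
    ≡⟨ cong (_++ reverse ds ++ ♯ ∷ reverse es) (reverse-replicate k □) ⟩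
  replicate k □ ++ reverse ds ++ ♯ ∷ reverse es ∎
  where open ≡-Reasoning

module _ {t y} (p : t Shows y) where
  open _Shows_ p

  private
    reversed : reverse (content t) ≡ replicate empty □ ++ reverse (numeral y) ++ ♯ ∷ reverse earlier
    reversed = trans (cong reverse shows) (reverse-shown earlier (numeral y) empty)

    digits : Digits (reverse (numeral y))
    digits = reverse-digits (numeral-digits y)

  shows-scan : scan (reverse (content t)) ≡ reverse (numeral y)
  shows-scan = trans (cong scan reversed)
    (trans (scan-blanks++ empty _)
      (trans (scan-digits++ digits _) (++-identityʳ _)))

  shows-mark : mark (reverse (content t)) ≡ 𝟏
  shows-mark = trans (cong mark reversed)
    (trans (mark-blanks++ empty _) (mark-digits++ digits _))

shows-unique : ∀ {t y z} → t Shows y → t Shows z → y ≡ z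
shows-unique {t} {y} {z} p q = numeral-injective y z (reverse-injective (trans (sym (shows-scan p)) (shows-scan q)))

reverse-content : ∀ ls s → reverse (content (tape ls s [])) ≡ s ∷ ls
reverse-content ls s =
  trans (reverse-++ (reverse ls) (s ∷ [])) (cong (s ∷_) (reverse-involutive ls))

-- Only what follows the last ♯ counts, so `P` can be simulated on top of older output.
shows-++ : ∀ {ls s y} es → tape ls s [] Shows y → tape (ls ++ es) s [] Shows y
shows-++ {ls} {s} {y} es p = record
  { earlier = reverse es ++ earlier
  ; empty   = empty
  ; shows   = begin
      reverse (ls ++ es) ++ s ∷ []
        ≡⟨ cong (_++ s ∷ []) (reverse-++ ls es) ⟩
      (reverse es ++ reverse ls) ++ s ∷ []
        ≡⟨ ++-assoc (reverse es) (reverse ls) (s ∷ []) ⟩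
      reverse es ++ reverse ls ++ s ∷ []
        ≡⟨ cong (reverse es ++_) shows ⟩
      reverse es ++ earlier ++ ♯ ∷ numeral y ++ replicate empty □
        ≡⟨ sym (++-assoc (reverse es) earlier _) ⟩
      (reverse es ++ earlier) ++ ♯ ∷ numeral y ++ replicate empty □ ∎
  }
  where
  open _Shows_ p
  open ≡-Reasoning

resultTape-shows : ∀ r → resultTape r Shows r
resultTape-shows r = record
  { earlier = []
  ; empty   = 1
  ; shows   = cong (_++ □ ∷ []) (reverse-involutive (♯ ∷ numeral r))
  }

-- Runs

-- In contrast to `HaltsAfter`, this does not ask the last configuration to be halting, so runs can
-- be concatenated.
data Run {C : Set} (next : C → C) (halted : C → Bool) : C → ℕ → C → Set where
  done : ∀ {c} → Run next halted c 0 c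
  tick : ∀ {c t c′} → halted c ≡ false → Run next halted (next c) t c′ → Run next halted c (suc t) c′

module _ {C : Set} {next : C → C} {halted : C → Bool} where

  infixr 5 _◅◅_
  _◅◅_ : ∀ {c₁ c₂ c₃ s t} → Run next halted c₁ s c₂ → Run next halted c₂ t c₃ → Run next halted c₁ (s + t) c₃
  done     ◅◅ r′ = r′
  tick h r ◅◅ r′ = tick h (r ◅◅ r′)

  tick′ : ∀ {c c₁ t c′} → halted c ≡ false → next c ≡ c₁ →
          Run next halted c₁ t c′ → Run next halted c (suc t) c′
  tick′ h refl r = tick h r

  run-iterate : ∀ {c t c′} → Run next halted c t c′ → iterate next c t ≡ c′
  run-iterate done       = refl
  run-iterate (tick _ r) = run-iterate r

  run-before : ∀ {c t c′} → Run next halted c t c′ → ∀ s → s < t → halted (iterate next c s) ≡ false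
  run-before (tick h r) zero    _         = h
  run-before (tick h r) (suc s) (s≤s s<t) = run-before r s s<t

  iterate-run : ∀ t c → (∀ s → s < t → halted (iterate next c s) ≡ false) → Run next halted c t (iterate next c t)
  iterate-run zero    c h = done
  iterate-run (suc t) c h = tick (h 0 (s≤s z≤n)) (iterate-run t (next c) λ s s<t → h (suc s) (s≤s s<t))

run-map : ∀ {C D : Set} {next : C → C} {halted : C → Bool} {next′ : D → D} {halted′ : D → Bool} (φ : C → D) →
          (∀ c → next′ (φ c) ≡ φ (next c)) → (∀ c → halted′ (φ c) ≡ halted c) →
          ∀ {c t c′} → Run next halted c t c′ → Run next′ halted′ (φ c) t (φ c′)
run-map φ hn hh done           = done
run-map φ hn hh (tick {c} h r) = tick′ (trans (hh c) h) (hn c) (run-map φ hn hh r)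

Steps : ∀ {m} (M : Machine m) → Config M → ℕ → Config M → Set
Steps M = Run (step M) (Machine.halting M ∘ state)

-- Machines whose tapes are arranged in blocks

Store : List ℕ → Set → Set
Store ns X = All (Vec X) ns

module _ {X : Set} where

  flatten : ∀ {ns} → Store ns X → Vec X (sum ns)
  flatten []      = []
  flatten (v ∷ s) = v Vec.++ flatten s

  unflatten : ∀ ns → Vec X (sum ns) → Store ns X
  unflatten []       v = []
  unflatten (n ∷ ns) v = Vec.take n v ∷ unflatten ns (Vec.drop n v)

  take-++ : ∀ {m n} (v : Vec X m) (w : Vec X n) → Vec.take m (v Vec.++ w) ≡ v
  take-++ []      w = refl
  take-++ (x ∷ v) w = cong (x ∷_) (take-++ v w)

  drop-++ : ∀ {m n} (v : Vec X m) (w : Vec X n) → Vec.drop m (v Vec.++ w) ≡ w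
  drop-++ []      w = refl
  drop-++ (x ∷ v) w = drop-++ v w

  unflatten-flatten : ∀ {ns} (s : Store ns X) → unflatten ns (flatten s) ≡ s
  unflatten-flatten []      = refl
  unflatten-flatten (v ∷ s) =
    cong₂ _∷_ (take-++ v (flatten s))
      (trans (cong (unflatten _) (drop-++ v (flatten s))) (unflatten-flatten s))

Action : Set
Action = Symbol × Move

keep : Symbol → Action
keep s = s , stay

-- `nothing` leaves a whole block as it is, so that `apply` computes even
-- when the block is a variable.
Actions : List ℕ → Set
Actions ns = All (λ n → Maybe (Vec Action n)) ns

heads : ∀ {ns} → Store ns Tape → Store ns Symbol
heads []      = []
heads (v ∷ s) = Vec.map head v ∷ heads s

applyBlock : ∀ {n} → Maybe (Vec Action n) → Vec Tape n → Vec Tape n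
applyBlock nothing   v = v
applyBlock (just as) v = Vec.zipWith act as v

apply : ∀ {ns} → Actions ns → Store ns Tape → Store ns Tape
apply []       []      = []
apply (a ∷ as) (v ∷ s) = applyBlock a v ∷ apply as s

fillBlock : ∀ {n} → Maybe (Vec Action n) → Vec Symbol n → Vec Action n
fillBlock nothing   ss = Vec.map keep ss
fillBlock (just as) ss = as

fill : ∀ {ns} → Actions ns → Store ns Symbol → Store ns Action
fill []       []        = []
fill (a ∷ as) (ss ∷ sss) = fillBlock a ss ∷ fill as sss

map-head-flatten : ∀ {ns} (s : Store ns Tape) → Vec.map head (flatten s) ≡ flatten (heads s)
map-head-flatten []      = refl
map-head-flatten (v ∷ s) =
  trans (Vec.map-++ head v (flatten s)) (cong (Vec.map head v Vec.++_) (map-head-flatten s))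

act-keep : ∀ {n} (v : Vec Tape n) → Vec.zipWith act (Vec.map keep (Vec.map head v)) v ≡ v
act-keep []      = refl
act-keep (t ∷ v) = cong (t ∷_) (act-keep v)

act-fillBlock : ∀ {n} (a : Maybe (Vec Action n)) v →
  Vec.zipWith act (fillBlock a (Vec.map head v)) v ≡ applyBlock a v
act-fillBlock nothing   v = act-keep v
act-fillBlock (just as) v = refl

act-fill : ∀ {ns} (as : Actions ns) (s : Store ns Tape) →
  Vec.zipWith act (flatten (fill as (heads s))) (flatten s) ≡ flatten (apply as s)
act-fill []       []      = refl
act-fill (a ∷ as) (v ∷ s) =
  trans (Vec.zipWith-++ act (fillBlock a (Vec.map head v)) _ v (flatten s))
    (cong₂ Vec._++_ (act-fillBlock a v) (act-fill as s))

blanks : ∀ ns → Store ns Tape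
blanks []       = []
blanks (n ∷ ns) = Vec.replicate n blank ∷ blanks ns

flatten-blanks : ∀ ns → Vec.replicate (sum ns) blank ≡ flatten (blanks ns)
flatten-blanks []       = refl
flatten-blanks (n ∷ ns) = trans (replicate-++ n) (cong (Vec.replicate n blank Vec.++_) (flatten-blanks ns))
  where
  replicate-++ : ∀ n {k} → Vec.replicate (n + k) blank ≡ Vec.replicate n blank Vec.++ Vec.replicate k blank
  replicate-++ zero    = refl
  replicate-++ (suc n) = cong (blank ∷_) (replicate-++ n)

record StoreMachine (m : ℕ) : Set₁ where
  field
    sizes   : List ℕ
    State   : Set
    size    : ℕ
    finite  : State ↔ Fin size
    start   : State
    halting : State → Bool
    δ       : State → Store (m ∷ sizes) Symbol → Symbol →
              State × Actions (m ∷ sizes) × (Symbol × OneWayMove)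

module Flatten {m : ℕ} (S : StoreMachine m) where
  open StoreMachine S

  machine : Machine m
  machine = record
    { work    = sum sizes
    ; State   = State
    ; size    = size
    ; finite  = finite
    ; start   = start
    ; halting = halting
    ; δ       = λ q ss o →
        let ss′ = unflatten (m ∷ sizes) ss
            r   = δ q ss′ o
        in proj₁ r , flatten (fill (proj₁ (proj₂ r)) ss′) , proj₂ (proj₂ r)
    }

  Conf : Set
  Conf = State × Store (m ∷ sizes) Tape × Tape

  next : Conf → Conf
  next (q , s , o) = case δ q (heads s) (head o) of λ where
    (q′ , as , (x , d)) → q′ , apply as s , act (x , toMove d) o

  halted : Conf → Bool
  halted (q , _) = halting q

  flat : Conf → Config machine
  flat (q , s , o) = config q (flatten s) o

  step-flat : ∀ c → step machine (flat c) ≡ flat (next c)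
  step-flat (q , s , o)
    rewrite map-head-flatten s
          | unflatten-flatten (heads s)
    = cong (λ v → config (proj₁ r) v (act (proj₁ (proj₂ (proj₂ r)) , toMove (proj₂ (proj₂ (proj₂ r)))) o))
        (act-fill (proj₁ (proj₂ r)) s)
    where r = δ q (heads s) (head o)

  initial-flat : ∀ xs o → initial machine xs o ≡ flat (start , Vec.map inputTape xs ∷ blanks sizes , o)
  initial-flat xs o = cong (λ v → config start (Vec.map inputTape xs Vec.++ v) o) (flatten-blanks sizes)

  run-flat : ∀ {c t c′} → Run next halted c t c′ → Steps machine (flat c) t (flat c′)
  run-flat = run-map flat step-flat (λ _ → refl)

-- Tapes read through a lazy copy

data Blanks : List Symbol → Set where
  []  : Blanks []
  □∷_ : ∀ {xs} → Blanks xs → Blanks (□ ∷ xs)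

-- Tapes are compared up to trailing blanks because `moveHead` lists the empty cells that the head
-- has passed.
data Padded : List Symbol → List Symbol → Set where
  pad : ∀ {xs} → Blanks xs → Padded [] xs
  _∷_ : ∀ x {xs ys} → Padded xs ys → Padded (x ∷ xs) (x ∷ ys)

unpadded : ∀ xs → Padded xs xs
unpadded []       = pad []
unpadded (x ∷ xs) = x ∷ unpadded xs

-- A blank flag means an unvisited cell, and a blank direction means that it was not entered by a
-- move to the left. Only then is the next symbol of the source due.
need : (flag dir : Symbol) → Bool
need □ □ = true
need _ _ = false

virtual : (source copy flag dir : Symbol) → Symbol
virtual s v □ □ = s
virtual s v _ _ = v

-- The value at `stay` is arbitrary: the cell just acted on is flagged, and on flagged cells the
-- direction is ignored.
direction : Move → Symbol
direction left  = 𝟏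
direction stay  = □
direction right = □

visit : Action → Action
visit (_ , m) = 𝟏 , m

turn : Action → Action
turn (_ , m) = direction m , stay

ones : List Symbol → List Symbol
ones = map (λ _ → 𝟏)

-- `Lazy rest v f d τ`: the tape τ is represented by its visited cells,
-- copied on v and flagged on f, and by the symbols `rest` of the source
-- that have not been fetched yet.  An unvisited cell is blank at the left
-- of the visited ones and the next symbol of the source at their right;
-- the direction of the last move, kept on d, tells the two cases apart.
data Lazy (rest : List Symbol) : (v f d τ : Tape) → Set where
  visited : ∀ ls s xs {d} →
    Lazy rest (tape ls s xs) (tape (ones ls) 𝟏 (ones xs)) (tape [] d []) (tape ls s (xs ++ rest))
  rightEdge : ∀ ls →
    Lazy rest (tape ls □ []) (tape (ones ls) □ []) (tape [] □ []) (tape ls (hd rest) (tl rest))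
  leftEdge : ∀ xs →
    Lazy rest (tape [] □ xs) (tape [] □ (ones xs)) (tape [] 𝟏 []) (tape [] □ (xs ++ rest))

fetch : Bool → List Symbol → List Symbol
fetch true  = tl
fetch false = id

lazy-read : ∀ {rest v f d τ} → Lazy rest v f d τ →
  virtual (hd rest) (head v) (head f) (head d) ≡ head τ
lazy-read (visited ls s xs) = refl
lazy-read (rightEdge ls)    = refl
lazy-read (leftEdge xs)     = refl

visited-move : ∀ {rest} ls s xs m →
  Lazy rest (moveHead m (tape ls s xs)) (moveHead m (tape (ones ls) 𝟏 (ones xs)))
    (tape [] (direction m) []) (moveHead m (tape ls s (xs ++ rest)))
visited-move          []       s xs       left  = leftEdge (s ∷ xs)
visited-move          (l ∷ ls) s xs       left  = visited ls l (s ∷ xs)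
visited-move          ls       s xs       stay  = visited ls s xs
visited-move {[]}     ls       s []       right = rightEdge (s ∷ ls)
visited-move {_ ∷ _}  ls       s []       right = rightEdge (s ∷ ls)
visited-move          ls       s (x ∷ xs) right = visited (s ∷ ls) x xs

lazy-act : ∀ {rest v f d τ} → Lazy rest v f d τ → ∀ a →
  Lazy (fetch (need (head f) (head d)) rest) (act a v) (act (visit a) f) (act (turn a) d) (act a τ)
lazy-act (visited ls _ xs) (s , m) = visited-move ls s xs m
lazy-act (rightEdge ls)    (s , m) = visited-move ls s [] m
lazy-act (leftEdge xs)     (s , m) = visited-move [] s xs m

lazy-initial : ∀ n → Lazy (numeral n) blank blank blank (inputTape n)
lazy-initial n rewrite inputTape-numeral n = rightEdge []

-- The head does not pass the first blank after the numeral. Hence all cells at its left are digits,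
-- up to the blank in front of the numeral, and a rewinding head can use that blank as a stop.
advance : Bool → Symbol → Action
advance true  𝟎 = 𝟎 , right
advance true  𝟏 = 𝟏 , right
advance true  ♯ = ♯ , right
advance true  □ = □ , stay
advance false s = s , stay

-- N bounds the number of digits read.
data Source (N : ℕ) (ds : List Symbol) : (rest : List Symbol) → Tape → Set where
  source : ∀ {read rest} → Digits read → Digits rest → read ʳ++ rest ≡ ds → length read ≤ N →
           Source N ds rest (tape read (hd rest) (tl rest))

source-read : ∀ {N ds rest t} → Source N ds rest t → head t ≡ hd rest
source-read (source _ _ _ _) = refl

source-advance : ∀ {N ds rest t} → Source N ds rest t → ∀ b →
  Source (suc N) ds (fetch b rest) (act (advance b (head t)) t)
source-advance (source r []            eq le) true  = source r [] eq (m≤n⇒m≤1+n le)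
source-advance (source r (𝟎 ∷ [])      eq le) true  = source (𝟎 ∷ r) [] eq (s≤s le)
source-advance (source r (𝟏 ∷ [])      eq le) true  = source (𝟏 ∷ r) [] eq (s≤s le)
source-advance (source r (𝟎 ∷ (d ∷ ds)) eq le) true = source (𝟎 ∷ r) (d ∷ ds) eq (s≤s le)
source-advance (source r (𝟏 ∷ (d ∷ ds)) eq le) true = source (𝟏 ∷ r) (d ∷ ds) eq (s≤s le)
source-advance (source r ds            eq le) false = source r ds eq (m≤n⇒m≤1+n le)

data Inputs (N : ℕ) : ∀ {m} → Vec ℕ m → (T V F D τ : Vec Tape m) → Set where
  []  : Inputs N [] [] [] [] [] []
  _∷_ : ∀ {m x t v f d τ rest} {xs : Vec ℕ m} {T V F D τs} →
        Source N (numeral x) rest t × Lazy rest v f d τ → Inputs N xs T V F D τs →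
        Inputs N (x ∷ xs) (t ∷ T) (v ∷ V) (f ∷ F) (d ∷ D) (τ ∷ τs)

virtuals : ∀ {m} (T V F D : Vec Symbol m) → Vec Symbol m
virtuals []      []      []      []      = []
virtuals (t ∷ T) (v ∷ V) (f ∷ F) (d ∷ D) = virtual t v f d ∷ virtuals T V F D

advances : ∀ {m} (T F D : Vec Symbol m) → Vec Action m
advances []      []      []      = []
advances (t ∷ T) (f ∷ F) (d ∷ D) = advance (need f d) t ∷ advances T F D

inputs-read : ∀ {N m} {xs : Vec ℕ m} {T V F D τ} → Inputs N xs T V F D τ →
  virtuals (Vec.map head T) (Vec.map head V) (Vec.map head F) (Vec.map head D) ≡ Vec.map head τ
inputs-read []                                      = refl
inputs-read (_∷_ {v = v} {f = f} {d = d} (s , l) i) =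
  cong₂ _∷_ (trans (cong (λ x → virtual x (head v) (head f) (head d)) (source-read s)) (lazy-read l)) (inputs-read i)

inputs-act : ∀ {N m} {xs : Vec ℕ m} {T V F D τ} → Inputs N xs T V F D τ → ∀ as →
  Inputs (suc N) xs
    (Vec.zipWith act (advances (Vec.map head T) (Vec.map head F) (Vec.map head D)) T)
    (Vec.zipWith act as V)
    (Vec.zipWith act (Vec.map visit as) F)
    (Vec.zipWith act (Vec.map turn as) D)
    (Vec.zipWith act as τ)
inputs-act []            []       = []
inputs-act (_∷_ {f = f} {d = d} (s , l) i) (a ∷ as) = (source-advance s (need (head f) (head d)) , lazy-act l a) ∷ inputs-act i as

inputs-initial : ∀ {m} (xs : Vec ℕ m) →
  Inputs 0 xs (Vec.map inputTape xs) (Vec.replicate m blank) (Vec.replicate m blank) (Vec.replicate m blank)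
    (Vec.map inputTape xs)
inputs-initial []       = []
inputs-initial (x ∷ xs) = (unread , lazy-initial x) ∷ inputs-initial xs
  where
  unread : Source 0 (numeral x) (numeral x) (inputTape x)
  unread rewrite inputTape-numeral x = source [] (numeral-digits x) refl z≤n

inputs-source : ∀ {N m} {xs : Vec ℕ m} {T V F D τ} → Inputs N xs T V F D τ → ∀ k →
  ∃[ rest ] Source N (numeral (Vec.lookup xs k)) rest (Vec.lookup T k)
inputs-source ((s , _) ∷ i) zero    = _ , s
inputs-source (_       ∷ i) (suc k) = inputs-source i k

-- Streams, read rightwards, and stacks, which grow rightwards

Stream : List Symbol → Tape → Set
Stream ds t = Padded ds (head t ∷ after t)

stream-read : ∀ {ds} t → Stream ds t → head t ≡ hd ds
stream-read t (pad (□∷ _)) = refl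
stream-read t (_ ∷ _)      = refl

stream-right : ∀ {ds} t s → Stream ds t → Stream (tl ds) (act (s , right) t)
stream-right (tape ls _ [])      s (pad (□∷ b)) = pad (□∷ [])
stream-right (tape ls _ (_ ∷ _)) s (pad (□∷ b)) = pad b
stream-right (tape ls _ [])      s (_ ∷ pad b)  = pad (□∷ [])
stream-right (tape ls _ (_ ∷ _)) s (_ ∷ p)      = p

-- A stack whose head stands on its top element.
Stack : List Symbol → Tape → Set
Stack ds t = Padded ds (leftwards t) × Blanks (after t)

-- A stack whose head stands on the empty cell above its top element.
Pile : List Symbol → Tape → Set
Pile ds t = head t ≡ □ × Padded ds (before t) × Blanks (after t)

stack-read : ∀ {ds t} → Stack ds t → head t ≡ hd ds
stack-read (pad (□∷ _) , _) = refl
stack-read (_ ∷ _      , _) = refl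

stack-pop : ∀ {ds t} → Stack ds t → Stack (tl ds) (act (□ , left) t)
stack-pop {t = tape []       s xs} (pad (□∷ b) , a) = pad (□∷ []) , □∷ a
stack-pop {t = tape (_ ∷ ls) s xs} (pad (□∷ b) , a) = pad b , □∷ a
stack-pop {t = tape []       s xs} (_ ∷ pad b  , a) = pad (□∷ []) , □∷ a
stack-pop {t = tape (_ ∷ ls) s xs} (_ ∷ p      , a) = p , □∷ a

pile-push : ∀ {ds t} s → Pile ds t → Pile (s ∷ ds) (act (s , right) t)
pile-push {t = tape ls _ []}      s (_ , p , a)    = refl , s ∷ p , []
pile-push {t = tape ls _ (_ ∷ _)} s (_ , p , □∷ a) = refl , s ∷ p , a

pile-open : ∀ {ds t} → Pile ds t → Stack ds (act (□ , left) t)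
pile-open {t = tape []      _ xs} (refl , pad b , a) = pad (□∷ b) , □∷ a
pile-open {t = tape (_ ∷ _) _ xs} (refl , p , a)     = p , □∷ a

stack-close : ∀ {t} → Stack [] t → Pile [] t
stack-close (pad (□∷ b) , a) = refl , pad b , a

-- The composed machine

pattern fetching  = 0F
pattern opening₀  = 1F
pattern pouring₀  = 2F
pattern opening₁  = 3F
pattern pouring₁  = 4F
pattern going     = 5F

-- A run of A followed by a run of P on (i , i , y), where i is the input
-- on the tape `ix` and y is the result of A.  The tape `base` holds the
-- result displayed when A starts, if there is one: A may obtain y by
-- writing digits at its right, and there is no time to copy it.
module Composition {m : ℕ} (A : Machine m) (P : Machine 3) (ix base : Fin m) where

  private
    module A = Machine A
    module P = Machine P

  Control : Set
  Control = Fin 7 ⊎ A.State ⊎ (P.State × Fin 6)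

  pattern setup     = inj₁ 0F
  pattern scanning  = inj₁ 1F
  pattern copying   = inj₁ 2F
  pattern seeking₀  = inj₁ 3F
  pattern backing₀  = inj₁ 4F
  pattern seeking₁  = inj₁ 5F
  pattern backing₁  = inj₁ 6F
  pattern inA q     = inj₂ (inj₁ q)
  pattern inP p j   = inj₂ (inj₂ (p , j))

  finite : Control ↔ Fin (7 + (A.size + P.size * 6))
  finite = ↔-trans (↔-refl ⊎-↔ ↔-trans (A.finite ⊎-↔ ↔-trans (P.finite ×-↔ ↔-refl) (↔-sym *↔×)) (↔-sym +↔⊎)) (↔-sym +↔⊎)

  halting : Control → Bool
  halting (inP p fetching) = P.halting p
  halting _                = false

  -- After the input tapes: the copies, flags and directions of the
  -- inputs of A, its work tapes; its output tape, two copies of the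
  -- digits in its result that it wrote itself, and a register that is 𝟏
  -- once it has written ♯; the copies, flags and directions of the
  -- inputs of P, its work tapes; the two queues of digits read from the
  -- tape `ix` for the first two inputs of P, which are read
  -- independently of each other although i is on a single tape.
  sizes : List ℕ
  sizes = m ∷ m ∷ m ∷ A.work ∷ 4 ∷ 9 ∷ P.work ∷ 2 ∷ 2 ∷ []

  idle : Actions (m ∷ sizes)
  idle = nothing ∷ nothing ∷ nothing ∷ nothing ∷ nothing ∷ nothing ∷ nothing ∷ nothing ∷ nothing ∷ nothing ∷ []

  onInputs : Vec Action m → Actions (m ∷ sizes)
  onInputs as = just as ∷ nothing ∷ nothing ∷ nothing ∷ nothing ∷ nothing ∷ nothing ∷ nothing ∷ nothing ∷ nothing ∷ []

  onResult : Vec Action 4 → Actions (m ∷ sizes)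
  onResult as = nothing ∷ nothing ∷ nothing ∷ nothing ∷ nothing ∷ just as ∷ nothing ∷ nothing ∷ nothing ∷ nothing ∷ []

  onQueues : Maybe (Vec Action 2) → Maybe (Vec Action 2) → Actions (m ∷ sizes)
  onQueues as bs = nothing ∷ nothing ∷ nothing ∷ nothing ∷ nothing ∷ nothing ∷ nothing ∷ nothing ∷ as ∷ bs ∷ []

  poke : Fin m → Move → Vec Symbol m → Vec Action m
  poke k d ss = Vec.map keep ss Vec.[ k ]≔ (Vec.lookup ss k , d)

  -- The cell under a one-way head can still be rewritten, so a ♯ is final only when the head moves
  -- on from it.
  note : OneWayMove → Symbol → Symbol → Symbol
  note right ♯ _ = 𝟏
  note _     _ b = b

  stepA : A.State → Store (m ∷ sizes) Symbol → Control × Actions (m ∷ sizes)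
  stepA q (T ∷ V ∷ F ∷ D ∷ w ∷ (O ∷ W ∷ U ∷ B ∷ []) ∷ _) =
    let r = A.δ q (virtuals T V F D Vec.++ w) O
        as = Vec.take m (proj₁ (proj₂ r))
        x = proj₁ (proj₂ (proj₂ r))
        d = proj₂ (proj₂ (proj₂ r))
    in inA (proj₁ r) ,
       just (advances T F D) ∷ just as ∷ just (Vec.map visit as) ∷ just (Vec.map turn as) ∷
       just (Vec.drop m (proj₁ (proj₂ r))) ∷
       just ((x , toMove d) ∷ keep W ∷ keep U ∷ keep (note d x B) ∷ []) ∷
       nothing ∷ nothing ∷ nothing ∷ nothing ∷ []

  usesBase : (register base : Symbol) → Bool
  usesBase □ s = not (isBlank s)
  usesBase _ s = false

  baseActions : Bool → Bool → Vec Symbol m → Maybe (Vec Action m)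
  baseActions true  true  T = just (poke base right T)
  baseActions _     _     T = nothing

  ownAction : Bool → Bool → Symbol → Action
  ownAction true false s = s , right
  ownAction _    _     s = keep s

  popAction : Bool → Symbol → Action
  popAction true  s = □ , left
  popAction false s = keep s

  goP : Symbol → Store (m ∷ sizes) Symbol → P.State × Vec Action (3 + P.work) × (Symbol × OneWayMove) →
        Control × Actions (m ∷ sizes) × (Symbol × OneWayMove)
  goP o (T ∷ V ∷ F ∷ D ∷ w ∷ (O ∷ W ∷ U ∷ B ∷ []) ∷ (v₀ ∷ f₀ ∷ d₀ ∷ v₁ ∷ f₁ ∷ d₁ ∷ v₂ ∷ f₂ ∷ d₂ ∷ []) ∷ wP ∷
         (i₀ ∷ o₀ ∷ []) ∷ (i₁ ∷ o₁ ∷ []) ∷ []) (p , (a₀ ∷ a₁ ∷ a₂ ∷ as) , a) =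
    let n₂ = need f₂ d₂
        u  = usesBase B (Vec.lookup T base)
    in inP p fetching ,
       baseActions n₂ u T ∷ nothing ∷ nothing ∷ nothing ∷ nothing ∷
       just (keep O ∷ ownAction n₂ u W ∷ keep U ∷ keep B ∷ []) ∷
       just (a₀ ∷ visit a₀ ∷ turn a₀ ∷ a₁ ∷ visit a₁ ∷ turn a₁ ∷ a₂ ∷ visit a₂ ∷ turn a₂ ∷ []) ∷
       just as ∷
       just (keep i₀ ∷ popAction (need f₀ d₀) o₀ ∷ []) ∷
       just (keep i₁ ∷ popAction (need f₁ d₁) o₁ ∷ []) ∷ [] ,
       a

  readP : Store (m ∷ sizes) Symbol → Vec Symbol (3 + P.work)
  readP (T ∷ V ∷ F ∷ D ∷ w ∷ (O ∷ W ∷ U ∷ B ∷ []) ∷ (v₀ ∷ f₀ ∷ d₀ ∷ v₁ ∷ f₁ ∷ d₁ ∷ v₂ ∷ f₂ ∷ d₂ ∷ []) ∷ wP ∷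
         (i₀ ∷ o₀ ∷ []) ∷ (i₁ ∷ o₁ ∷ []) ∷ []) =
    let tb = Vec.lookup T base in
    virtual o₀ v₀ f₀ d₀ ∷ virtual o₁ v₁ f₁ d₁ ∷
    virtual (if usesBase B tb then tb else W) v₂ f₂ d₂ ∷ wP

  rewind : Fin m → Control → Control → Vec Symbol m → Control × Actions (m ∷ sizes)
  rewind k loop exit T =
    if isBlank (Vec.lookup T k) then (exit , onInputs (poke k right T)) else (loop , onInputs (poke k left T))

  openStep : Control → Control → Symbol → Control × Maybe (Vec Action 2)
  openStep pour exit □ = pour , just ((□ , left) ∷ keep □ ∷ [])
  openStep pour exit _ = exit , nothing

  pourStep : Control → Control → Vec Symbol 2 → Control × Maybe (Vec Action 2)
  pourStep loop exit (□ ∷ o ∷ []) = exit , just (keep □ ∷ (□ , left) ∷ [])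
  pourStep loop exit (s ∷ o ∷ []) = loop , just ((□ , left) ∷ (s , right) ∷ [])

  -- Both queues receive the digit, whichever input of `P` asks for it. One digit before every step
  -- of `P` is enough: a queue is then nonempty when it is read, unless the source is exhausted.
  fetchStep : P.State → Vec Symbol m → Symbol → Symbol → Symbol → Symbol → Control × Actions (m ∷ sizes)
  fetchStep p T i₀ o₀ i₁ o₁ with Vec.lookup T ix
  ... | □ = inP p opening₀ , idle
  ... | s = inP p opening₀ , just (poke ix right T) ∷ nothing ∷ nothing ∷ nothing ∷ nothing ∷ nothing ∷ nothing ∷ nothing ∷
            just ((s , right) ∷ keep o₀ ∷ []) ∷ just ((s , right) ∷ keep o₁ ∷ []) ∷ []

  -- If `A` wrote ♯, its result replaces the old one and needs a ♯ in front. Otherwise its digits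
  -- continue the old result, which is still the last one on the output tape.
  announce : (register o : Symbol) → Symbol × OneWayMove
  announce 𝟏 o = ♯ , right
  announce _ o = o , stay

  -- Reading and writing both go leftwards, so the digits keep their order. Two copies are made
  -- because copying to the output carries the head of `U` to the end, while `W` stays at its first
  -- digit, ready for `P`.
  scanStep : (O W U B o : Symbol) → Control × Actions (m ∷ sizes) × (Symbol × OneWayMove)
  scanStep □ W U B o = scanning , onResult ((□ , left) ∷ keep W ∷ keep U ∷ keep B ∷ []) , (o , stay)
  scanStep 𝟎 W U B o = scanning , onResult ((𝟎 , left) ∷ (𝟎 , left) ∷ (𝟎 , left) ∷ keep B ∷ []) , (o , stay)
  scanStep 𝟏 W U B o = scanning , onResult ((𝟏 , left) ∷ (𝟏 , left) ∷ (𝟏 , left) ∷ keep B ∷ []) , (o , stay)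
  scanStep ♯ W U B o = copying , onResult (keep ♯ ∷ (W , right) ∷ (U , right) ∷ keep B ∷ []) , announce B o

  copyStep : (O W U B o : Symbol) → Control × Actions (m ∷ sizes) × (Symbol × OneWayMove)
  copyStep O W □ B o = seeking₀ , idle , (o , stay)
  copyStep O W s B o = copying , onResult (keep O ∷ keep W ∷ (s , right) ∷ keep B ∷ []) , (s , right)

  δ : Control → Store (m ∷ sizes) Symbol → Symbol → Control × Actions (m ∷ sizes) × (Symbol × OneWayMove)
  -- This ♯ is the sentinel that ends the scan if `A` writes no ♯ itself.
  δ setup (_ ∷ _ ∷ _ ∷ _ ∷ _ ∷ (O ∷ W ∷ U ∷ B ∷ []) ∷ _) o =
    inA A.start , onResult ((♯ , right) ∷ keep W ∷ keep U ∷ keep B ∷ []) , (o , stay)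
  δ (inA q) s o =
    if A.halting q then (scanning , idle , (o , stay))
    else (proj₁ (stepA q s) , proj₂ (stepA q s) , (o , stay))
  δ scanning (_ ∷ _ ∷ _ ∷ _ ∷ _ ∷ (O ∷ W ∷ U ∷ B ∷ []) ∷ _) o = scanStep O W U B o
  δ copying  (_ ∷ _ ∷ _ ∷ _ ∷ _ ∷ (O ∷ W ∷ U ∷ B ∷ []) ∷ _) o = copyStep O W U B o
  δ seeking₀ (T ∷ _) o = backing₀ , onInputs (poke ix left T) , (o , stay)
  δ backing₀ (T ∷ _) o = let r = rewind ix backing₀ seeking₁ T in proj₁ r , proj₂ r , (o , stay)
  δ seeking₁ (T ∷ _) o = backing₁ , onInputs (poke base left T) , (o , stay)
  δ backing₁ (T ∷ _) o = let r = rewind base backing₁ (inP P.start fetching) T in proj₁ r , proj₂ r , (o , stay)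
  δ (inP p fetching) (T ∷ _ ∷ _ ∷ _ ∷ _ ∷ _ ∷ _ ∷ _ ∷ (i₀ ∷ o₀ ∷ []) ∷ (i₁ ∷ o₁ ∷ []) ∷ []) o =
    let r = fetchStep p T i₀ o₀ i₁ o₁ in proj₁ r , proj₂ r , (o , stay)
  δ (inP p opening₀) (_ ∷ _ ∷ _ ∷ _ ∷ _ ∷ _ ∷ _ ∷ _ ∷ (i₀ ∷ o₀ ∷ []) ∷ _ ∷ []) o =
    let r = openStep (inP p pouring₀) (inP p opening₁) o₀ in proj₁ r , onQueues (proj₂ r) nothing , (o , stay)
  δ (inP p pouring₀) (_ ∷ _ ∷ _ ∷ _ ∷ _ ∷ _ ∷ _ ∷ _ ∷ io ∷ _ ∷ []) o =
    let r = pourStep (inP p pouring₀) (inP p opening₁) io in proj₁ r , onQueues (proj₂ r) nothing , (o , stay)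
  δ (inP p opening₁) (_ ∷ _ ∷ _ ∷ _ ∷ _ ∷ _ ∷ _ ∷ _ ∷ _ ∷ (i₁ ∷ o₁ ∷ []) ∷ []) o =
    let r = openStep (inP p pouring₁) (inP p going) o₁ in proj₁ r , onQueues nothing (proj₂ r) , (o , stay)
  δ (inP p pouring₁) (_ ∷ _ ∷ _ ∷ _ ∷ _ ∷ _ ∷ _ ∷ _ ∷ _ ∷ io ∷ []) o =
    let r = pourStep (inP p pouring₁) (inP p going) io in proj₁ r , onQueues nothing (proj₂ r) , (o , stay)
  δ (inP p going) s o = goP o s (P.δ p (readP s) o)

  storeMachine : StoreMachine m
  storeMachine = record
    { sizes   = sizes
    ; State   = Control
    ; size    = _
    ; finite  = finite
    ; start   = setup
    ; halting = halting
    ; δ       = δ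
    }

  open Flatten storeMachine public

-- Simulation of the first machine

module FirstPhase {m : ℕ} (A : Machine m) (P : Machine 3) (ix base : Fin m) where

  open Composition A P ix base
  private
    module A = Machine A
    module P = Machine P

  Reaches : Conf → ℕ → (Conf → Set) → Set
  Reaches c b Q = ∃[ t ] ∃[ c′ ] (Run next halted c t c′ × t ≤ b × Q c′)

  infixl 1 _>>=_
  _>>=_ : ∀ {c b b′ Q Q′} → Reaches c b Q → (∀ {c′} → Q c′ → Reaches c′ b′ Q′) → Reaches c (b + b′) Q′
  (t , c′ , r , le , q) >>= f =
    let t′ , c″ , r′ , le′ , q′ = f q in t + t′ , c″ , r ◅◅ r′ , +-mono-≤ le le′ , q′

  note-mark : ∀ s xs → note right s (mark xs) ≡ mark (s ∷ xs)
  note-mark 𝟎 xs = refl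
  note-mark 𝟏 xs = refl
  note-mark ♯ xs = refl
  note-mark □ xs = refl

  -- The output of A to the right of `out` is kept on a tape of its own,
  -- whose first cell holds ♯.
  data SimA (xs : Vec ℕ m) (out : Tape) (N : ℕ) : Config A → Conf → Set where
    simA : ∀ {T V F D τ} {w : Vec Tape A.work} {q h} X →
      Inputs N xs T V F D τ → length X ≤ N →
      SimA xs out N
        (config q (τ Vec.++ w) (tape (X ++ before out) h []))
        (inA q ,
         (T ∷ V ∷ F ∷ D ∷ w ∷ (tape (X ++ ♯ ∷ []) h [] ∷ blank ∷ blank ∷ tape [] (mark X) [] ∷ []) ∷
          blanks (9 ∷ P.work ∷ 2 ∷ 2 ∷ [])) ,
         out)

  simA-output : ∀ {xs out N T V F D τ} {w : Vec Tape A.work} {q h} X s d →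
    Inputs N xs T V F D τ → suc (length X) ≤ N →
    SimA xs out N
      (config q (τ Vec.++ w) (act (s , toMove d) (tape (X ++ before out) h [])))
      (inA q ,
       (T ∷ V ∷ F ∷ D ∷ w ∷
        (act (s , toMove d) (tape (X ++ ♯ ∷ []) h []) ∷ blank ∷ blank ∷ tape [] (note d s (mark X)) [] ∷ []) ∷
        blanks (9 ∷ P.work ∷ 2 ∷ 2 ∷ [])) ,
       out)
  simA-output X s stay  i le = simA X i (<⇒≤ le)
  simA-output X s right i le rewrite note-mark s X = simA (s ∷ X) i le

  zipWith-take-drop : ∀ {n} (as : Vec Action (m + n)) (τ : Vec Tape m) (w : Vec Tape n) →
    Vec.zipWith act as (τ Vec.++ w) ≡
    Vec.zipWith act (Vec.take m as) τ Vec.++ Vec.zipWith act (Vec.drop m as) w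
  zipWith-take-drop as τ w =
    trans (cong (λ bs → Vec.zipWith act bs (τ Vec.++ w)) (sym (Vec.take++drop≡id m as)))
      (Vec.zipWith-++ act (Vec.take m as) (Vec.drop m as) τ w)

  simA-step : ∀ {xs out N c k} → A.halting (state c) ≡ false →
    SimA xs out N c k → SimA xs out (suc N) (step A c) (next k)
  simA-step {out = out} h (simA {T} {V} {F} {D} {τ} {w} {q} {x} X i le)
    rewrite h
          | inputs-read i
          | Vec.map-++ head τ w
          | zipWith-take-drop (proj₁ (proj₂ (A.δ q (Vec.map head τ Vec.++ Vec.map head w) x))) τ w
    = simA-output {h = x} X _ _ (inputs-act i _) (s≤s le)

  -- Fetching from the source happens within the simulated step, so `A` runs at its own speed.
  simA-run : ∀ {xs out N c t c′ k} → Steps A c t c′ → SimA xs out N c k →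
    ∃[ k′ ] (Run next halted k t k′ × SimA xs out (t + N) c′ k′)
  simA-run done s = _ , done , s
  simA-run {xs} {out} {N} {t = suc t} {c′} (tick h r) s@(simA _ _ _) =
    let k′ , r′ , s′ = simA-run r (simA-step h s)
    in k′ , tick refl r′ , subst (λ n → SimA xs out n c′ k′) (+-suc t N) s′

  -- Reading the result of A off its output

  fromLeft : List Symbol → List Symbol → Tape
  fromLeft []       xs = tape [] □ xs
  fromLeft (s ∷ ls) xs = tape ls s xs

  move-left : ∀ ls s xs → moveHead left (tape ls s xs) ≡ fromLeft ls (s ∷ xs)
  move-left []      s xs = refl
  move-left (_ ∷ _) s xs = refl

  move-right : ∀ ls s xs → moveHead right (tape ls s xs) ≡ tape (s ∷ ls) (hd xs) (tl xs)
  move-right ls s []      = refl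
  move-right ls s (_ ∷ _) = refl

  announced : Symbol → Tape → Tape
  announced b o = act (proj₁ (announce b (head o)) , toMove (proj₂ (announce b (head o)))) o

  tick-reaches : ∀ c {c₁ b Q} → halted c ≡ false → next c ≡ c₁ → Reaches c₁ b Q → Reaches c (suc b) Q
  tick-reaches c h e (t , c′ , r , le , q) = suc t , c′ , tick′ h e r , s≤s le , q

  module _ (T V F D : Vec Tape m) (w : Vec Tape A.work)
           (L : Vec Tape 9) (wP : Vec Tape P.work) (Q₀ Q₁ : Vec Tape 2) where

    result : Control → (O W U B o : Tape) → Conf
    result q O W U B o = q , (T ∷ V ∷ F ∷ D ∷ w ∷ (O ∷ W ∷ U ∷ B ∷ []) ∷ L ∷ wP ∷ Q₀ ∷ Q₁ ∷ []) , o

    Scanned : (B o : Tape) → List Symbol → Conf → Set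
    Scanned B o ds c = ∃[ O ] c ≡ result copying O
      (tape (□ ∷ []) (hd ds) (tl ds)) (tape (□ ∷ []) (hd ds) (tl ds)) B (announced (head B) o)

    scan-stop : ∀ ls xs ds B o b →
      Reaches (result scanning (tape ls ♯ xs) (tape [] □ ds) (tape [] □ ds) B o) (suc b) (Scanned B o ds)
    scan-stop ls xs ds B o b =
      tick-reaches (result scanning (tape ls ♯ xs) (tape [] □ ds) (tape [] □ ds) B o) refl
        (cong₂ (λ W U → result copying (tape ls ♯ xs) W U B (announced (head B) o))
          (move-right [] □ ds) (move-right [] □ ds))
        (0 , _ , done , z≤n , _ , refl)

    scan-reaches : ∀ ys xs ds B o →
      Reaches (result scanning (fromLeft (ys ++ ♯ ∷ []) xs) (tape [] □ ds) (tape [] □ ds) B o)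
        (suc (length ys)) (Scanned B o (scan (ys ++ ♯ ∷ []) ʳ++ ds))
    scan-reaches []       xs ds B o = scan-stop [] xs ds B o 0
    scan-reaches (♯ ∷ ys) xs ds B o = scan-stop (ys ++ ♯ ∷ []) xs ds B o (suc (length ys))
    scan-reaches (□ ∷ ys) xs ds B o =
      tick-reaches (result scanning (tape (ys ++ ♯ ∷ []) □ xs) (tape [] □ ds) (tape [] □ ds) B o) refl
        (cong (λ O → result scanning O (tape [] □ ds) (tape [] □ ds) B o) (move-left (ys ++ ♯ ∷ []) □ xs))
        (scan-reaches ys (□ ∷ xs) ds B o)
    scan-reaches (𝟎 ∷ ys) xs ds B o =
      tick-reaches (result scanning (tape (ys ++ ♯ ∷ []) 𝟎 xs) (tape [] □ ds) (tape [] □ ds) B o) refl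
        (cong (λ O → result scanning O (tape [] □ (𝟎 ∷ ds)) (tape [] □ (𝟎 ∷ ds)) B o) (move-left (ys ++ ♯ ∷ []) 𝟎 xs))
        (scan-reaches ys (𝟎 ∷ xs) (𝟎 ∷ ds) B o)
    scan-reaches (𝟏 ∷ ys) xs ds B o =
      tick-reaches (result scanning (tape (ys ++ ♯ ∷ []) 𝟏 xs) (tape [] □ ds) (tape [] □ ds) B o) refl
        (cong (λ O → result scanning O (tape [] □ (𝟏 ∷ ds)) (tape [] □ (𝟏 ∷ ds)) B o) (move-left (ys ++ ♯ ∷ []) 𝟏 xs))
        (scan-reaches ys (𝟏 ∷ xs) (𝟏 ∷ ds) B o)

    copy-reaches : ∀ {ds} → Digits ds → ∀ us O W B os →
      Reaches (result copying O W (tape us (hd ds) (tl ds)) B (tape os □ [])) (suc (length ds))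
        (λ c → ∃[ U ] c ≡ result seeking₀ O W U B (tape (ds ʳ++ os) □ []))
    copy-reaches [] us O W B os =
      tick-reaches (result copying O W (tape us □ []) B (tape os □ [])) refl refl (0 , _ , done , z≤n , _ , refl)
    copy-reaches {𝟎 ∷ ds} (𝟎 ∷ p) us O W B os =
      tick-reaches (result copying O W (tape us 𝟎 ds) B (tape os □ [])) refl
        (cong (λ U → result copying O W U B (tape (𝟎 ∷ os) □ [])) (move-right us 𝟎 ds))
        (copy-reaches p (𝟎 ∷ us) O W B (𝟎 ∷ os))
    copy-reaches {𝟏 ∷ ds} (𝟏 ∷ p) us O W B os =
      tick-reaches (result copying O W (tape us 𝟏 ds) B (tape os □ [])) refl
        (cong (λ U → result copying O W U B (tape (𝟏 ∷ os) □ [])) (move-right us 𝟏 ds))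
        (copy-reaches p (𝟏 ∷ us) O W B (𝟏 ∷ os))

  -- Rewinding an input tape

  poke-act : ∀ {n} k d (T : Vec Tape n) t →
    Vec.zipWith act (Vec.map keep (Vec.map head (T Vec.[ k ]≔ t)) Vec.[ k ]≔
      (Vec.lookup (Vec.map head (T Vec.[ k ]≔ t)) k , d)) (T Vec.[ k ]≔ t) ≡ T Vec.[ k ]≔ moveHead d t
  poke-act zero    d (_ ∷ T) t = cong (moveHead d t ∷_) (act-keep T)
  poke-act (suc k) d (s ∷ T) t = cong (s ∷_) (poke-act k d T t)

  poke-lookup : ∀ k d T → Vec.zipWith act (poke k d (Vec.map head T)) T ≡ T Vec.[ k ]≔ moveHead d (Vec.lookup T k)
  poke-lookup k d T =
    trans (cong (λ T′ → Vec.zipWith act (poke k d (Vec.map head T′)) T′) (sym (Vec.[]≔-lookup T k)))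
      (poke-act k d T (Vec.lookup T k))

  lookup-head : ∀ {n} (T : Vec Tape n) k t → Vec.lookup (Vec.map head (T Vec.[ k ]≔ t)) k ≡ head t
  lookup-head T k t = trans (Vec.lookup-map k head (T Vec.[ k ]≔ t)) (cong head (Vec.lookup∘update k T t))

  data Rewindable (read rest : List Symbol) (t : Tape) : Set where
    rewindable : Digits read → Padded read (before t) → Stream rest t → Rewindable read rest t

  module _ (k : Fin m) {seek back exit : Control} (G : Store sizes Tape) (o : Tape)
           (seeks   : ∀ T → next (seek , T ∷ G , o) ≡ (back , Vec.zipWith act (poke k left (Vec.map head T)) T ∷ G , o))
           (turns   : ∀ T → isBlank (Vec.lookup (Vec.map head T) k) ≡ true →
                      next (back , T ∷ G , o) ≡ (exit , Vec.zipWith act (poke k right (Vec.map head T)) T ∷ G , o))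
           (backs   : ∀ T → isBlank (Vec.lookup (Vec.map head T) k) ≡ false →
                      next (back , T ∷ G , o) ≡ (back , Vec.zipWith act (poke k left (Vec.map head T)) T ∷ G , o))
           (seeks-on : halting seek ≡ false) (backs-on : halting back ≡ false)
           (T : Vec Tape m) where

    Rewound : List Symbol → Conf → Set
    Rewound ds c = ∃[ t ] (c ≡ (exit , (T Vec.[ k ]≔ t) ∷ G , o) × Rewindable [] ds t)

    back-reaches : ∀ read {rest t} → Digits read → Padded read (leftwards t) → Padded rest (after t) →
      Reaches (back , (T Vec.[ k ]≔ t) ∷ G , o) (suc (length read)) (Rewound (read ʳ++ rest))
    back-reaches [] {rest} {t@(tape ls □ xs)} [] (pad (□∷ bl)) p =
      tick-reaches (back , (T Vec.[ k ]≔ t) ∷ G , o) backs-on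
        (trans (turns _ (cong isBlank (lookup-head T k t))) (cong (λ v → exit , v ∷ G , o) (poke-act k right T t)))
        (0 , _ , done , z≤n , moveHead right t , refl , moved xs p)
      where
      moved : ∀ xs → Padded rest xs → Rewindable [] rest (moveHead right (tape ls □ xs))
      moved []       (pad [])   = rewindable [] (pad (□∷ bl)) (pad (□∷ []))
      moved (x ∷ xs) p          = rewindable [] (pad (□∷ bl)) p
    back-reaches (d ∷ read) {rest} {t@(tape ls .d xs)} (isD ∷ ds) (.d ∷ p) q =
      tick-reaches (back , (T Vec.[ k ]≔ t) ∷ G , o) backs-on
        (trans (backs _ (trans (cong isBlank (lookup-head T k t)) (isBlank-digit isD)))
          (cong (λ v → back , v ∷ G , o) (poke-act k left T t)))
        (back-reaches read ds (left-padded ls p) (left-after ls))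
      where
      left-padded : ∀ ls → Padded read ls → Padded read (leftwards (moveHead left (tape ls d xs)))
      left-padded []      (pad b) = pad (□∷ [])
      left-padded (_ ∷ _) p       = p
      left-after : ∀ ls → Padded (d ∷ rest) (after (moveHead left (tape ls d xs)))
      left-after []      = d ∷ q
      left-after (_ ∷ _) = d ∷ q

    rewind-reaches : ∀ {read rest} → Rewindable read rest (Vec.lookup T k) →
      Reaches (seek , T ∷ G , o) (2 + length read) (Rewound (read ʳ++ rest))
    rewind-reaches {read} {rest} (rewindable ds p q) =
      tick-reaches (seek , T ∷ G , o) seeks-on (trans (seeks T) (cong (λ v → back , v ∷ G , o) (poke-lookup k left T)))
        (back-reaches read ds (left-padded (Vec.lookup T k) p) (left-after (Vec.lookup T k) q))
      where
      left-padded : ∀ t → Padded read (before t) → Padded read (leftwards (moveHead left t))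
      left-padded (tape []      _ _) (pad b) = pad (□∷ [])
      left-padded (tape (_ ∷ _) _ _) p       = p
      left-after : ∀ t → Stream rest t → Padded rest (after (moveHead left t))
      left-after (tape []      _ _) p = p
      left-after (tape (_ ∷ _) _ _) p = p

-- Queues made of two stacks

record Queue (a b : List Symbol) (i o : Tape) : Set where
  field
    pile         : Pile a i
    pile-digits  : Digits a
    stack        : Stack b o
    stack-digits : Digits b

-- What remains to be read: the stack b from its top, then the pile a from
-- its bottom, then the rest ss of the source.
queued : (a b ss : List Symbol) → List Symbol
queued a b ss = b ++ (a ʳ++ ss)

ʳ++-assoc : ∀ (xs : List Symbol) {ys zs} → (xs ʳ++ ys) ++ zs ≡ xs ʳ++ (ys ++ zs)
ʳ++-assoc []       = refl
ʳ++-assoc (x ∷ xs) = ʳ++-assoc xs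

ʳ++-[]⁻¹ : ∀ (xs : List Symbol) → xs ʳ++ [] ≡ [] → xs ≡ []
ʳ++-[]⁻¹ []       _  = refl
ʳ++-[]⁻¹ (x ∷ xs) eq =
  contradiction (trans (sym (length-ʳ++ xs)) (cong length eq)) (m+1+n≢0 (length xs))

-- Abstracting from the configuration lets one argument serve both queues.
record Transfer {C : Set} (next : C → C) (halted : C → Bool) (opening pouring exit : Tape → Tape → C) : Set where
  field
    opening-on : ∀ i o → halted (opening i o) ≡ false
    pouring-on : ∀ i o → halted (pouring i o) ≡ false
    opens      : ∀ i o → head o ≡ □ → next (opening i o) ≡ pouring (act (□ , left) i) o
    skips      : ∀ i o → IsDigit (head o) → next (opening i o) ≡ exit i o
    pours      : ∀ i o → IsDigit (head i) → next (pouring i o) ≡ pouring (act (□ , left) i) (act (head i , right) o)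
    closes     : ∀ i o → head i ≡ □ → next (pouring i o) ≡ exit i (act (□ , left) o)

module Pouring {C : Set} {next : C → C} {halted : C → Bool} {opening pouring exit : Tape → Tape → C}
               (transfer : Transfer next halted opening pouring exit) where

  open Transfer transfer

  pour-run : ∀ a {b i o} → Stack a i → Digits a → Pile b o → Digits b →
    ∃[ i′ ] ∃[ o′ ] (Run next halted (pouring i o) (suc (length a)) (exit i′ o′) × Queue [] (a ʳ++ b) i′ o′)
  pour-run [] {b} {i} {o} s [] p db =
    i , act (□ , left) o , tick′ (pouring-on i o) (closes i o (stack-read s)) done ,
    record { pile = stack-close s ; pile-digits = [] ; stack = pile-open p ; stack-digits = db }
  pour-run (d ∷ a) {b} {i} {o} s (isD ∷ da) p db =
    let i′ , o′ , r , q = pour-run a (stack-pop s) da (pile-push d p) (isD ∷ db)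
    in i′ , o′ ,
       tick′ (pouring-on i o)
         (trans (pours i o (subst IsDigit (sym (stack-read s)) isD))
           (cong (λ x → pouring (act (□ , left) i) (act (x , right) o)) (stack-read s)))
         r ,
       q

  -- `bound` is amortised: the time for pouring is paid for by the pile, which is left empty.
  -- `exhausted` says that the stack is empty afterwards only if the whole queue was.
  record Opened (a b : List Symbol) (i o : Tape) : Set where
    field
      {i′ o′}   : Tape
      {a′ b′}   : List Symbol
      time      : ℕ
      run       : Run next halted (opening i o) time (exit i′ o′)
      bound     : time + length a′ ≤ 2 + length a
      queue     : Queue a′ b′ i′ o′
      unchanged : ∀ ss → queued a′ b′ ss ≡ queued a b ss
      exhausted : b′ ≡ [] → a ≡ [] × a′ ≡ []

  open-run : ∀ {a b i o} → Queue a b i o → Opened a b i o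
  open-run {a} {[]} {i} {o} q =
    let open Queue q
        i′ , o′ , r , q′ = pour-run a (pile-open pile) pile-digits (stack-close stack) []
    in record
      { time      = 2 + length a
      ; run       = tick′ (opening-on i o) (opens i o (stack-read stack)) r
      ; bound     = ≤-reflexive (+-identityʳ (2 + length a))
      ; queue     = q′
      ; unchanged = λ ss → ʳ++-assoc a
      ; exhausted = λ eq → ʳ++-[]⁻¹ a eq , refl
      }
  open-run {a} {d ∷ b} {i} {o} q =
    let open Queue q in record
      { time      = 1
      ; run       = tick′ (opening-on i o)
                      (skips i o (subst IsDigit (sym (stack-read stack)) (All.head stack-digits))) done
      ; bound     = n≤1+n _
      ; queue     = q
      ; unchanged = λ ss → refl
      ; exhausted = λ ()
      }

-- Simulation of the second machine

module SecondPhase {m : ℕ} (A : Machine m) (P : Machine 3) (ix base : Fin m) where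

  open Composition A P ix base
  open FirstPhase A P ix base using (poke-lookup; Reaches)
  private
    module A = Machine A
    module P = Machine P

  -- `ready` is what opening the queue provides: an empty stack means that the whole input has been
  -- read, and then popping a blank agrees with fetching beyond the end.
  pop : ∀ n {a b ss i o} → Queue a b i o → (b ≡ [] → a ʳ++ ss ≡ []) →
    ∃[ b′ ] (Queue a b′ i (act (popAction n (head o)) o) × fetch n (queued a b ss) ≡ queued a b′ ss)
  pop false {b = b} q ready = b , q , refl
  pop true {a} {[]} {ss} q ready =
    [] , record { Queue q; stack = stack-pop (Queue.stack q); stack-digits = [] } ,
    trans (cong tl (ready refl)) (sym (ready refl))
  pop true {b = d ∷ b} q ready =
    b , record { Queue q; stack = stack-pop (Queue.stack q); stack-digits = All.tail (Queue.stack-digits q) } , refl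

  queue-read : ∀ {a b i o} ss → Queue a b i o → (b ≡ [] → a ʳ++ ss ≡ []) → head o ≡ hd (queued a b ss)
  queue-read {b = []}    ss q ready = trans (stack-read (Queue.stack q)) (sym (cong hd (ready refl)))
  queue-read {b = _ ∷ _} ss q ready = stack-read (Queue.stack q)

  -- The third input of P consists of the digits on W, preceded by the
  -- content of the tape `base` if A has not written ♯.
  data Third (T : Vec Tape m) : (B W : Tape) → List Symbol → Set where
    ownOnly   : ∀ {W ds} → Stream ds W → Third T (tape [] 𝟏 []) W ds
    -- The tape `ix` is advanced by fetching and `base` by reading the third input; one head cannot
    -- do both, hence `base ≢ ix`.
    baseFirst : ∀ {W bs ds} → base ≢ ix → Digits bs → Stream bs (Vec.lookup T base) → Stream ds W →
                Third T (tape [] □ []) W (bs ++ ds)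

  thirdSymbol : (B base W : Symbol) → Symbol
  thirdSymbol B s W = if usesBase B s then s else W

  third-read : ∀ {T B W rest} → Third T B W rest →
    thirdSymbol (head B) (Vec.lookup (Vec.map head T) base) (head W) ≡ hd rest
  third-read {W = W} (ownOnly s) = stream-read W s
  third-read {T} {W = W} (baseFirst ne ds p q)
    rewrite Vec.lookup-map base head T | stream-read (Vec.lookup T base) p with ds
  ... | []    = stream-read W q
  ... | 𝟎 ∷ _ = refl
  ... | 𝟏 ∷ _ = refl

  movedBase : Bool → Symbol → Vec Tape m → Vec Tape m
  movedBase n b T = applyBlock (baseActions n (usesBase b (Vec.lookup (Vec.map head T) base)) (Vec.map head T)) T

  movedOwn : Bool → Symbol → Vec Tape m → Tape → Tape
  movedOwn n b T W = act (ownAction n (usesBase b (Vec.lookup (Vec.map head T) base)) (head W)) W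

  module _ (T : Vec Tape m) where

    movedBase-blank : isBlank (Vec.lookup (Vec.map head T) base) ≡ true → movedBase true □ T ≡ T
    movedBase-blank h rewrite h = refl

    movedOwn-blank : ∀ W → isBlank (Vec.lookup (Vec.map head T) base) ≡ true → movedOwn true □ T W ≡ act (head W , right) W
    movedOwn-blank W h rewrite h = refl

    movedBase-nonblank : isBlank (Vec.lookup (Vec.map head T) base) ≡ false →
      movedBase true □ T ≡ T Vec.[ base ]≔ moveHead right (Vec.lookup T base)
    movedBase-nonblank h rewrite h = poke-lookup base right T

    movedOwn-nonblank : ∀ W → isBlank (Vec.lookup (Vec.map head T) base) ≡ false → movedOwn true □ T W ≡ W
    movedOwn-nonblank W h rewrite h = refl

  third-act : ∀ n {T B W rest} → Third T B W rest → Third (movedBase n (head B) T) B (movedOwn n (head B) T W) (fetch n rest)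
  third-act false         (ownOnly s)           = ownOnly s
  third-act true  {W = W} (ownOnly s)           = ownOnly (stream-right W (head W) s)
  third-act false         (baseFirst ne ds p q) = baseFirst ne ds p q
  third-act true {T} {W = W} (baseFirst {bs = []} {ds} ne [] p q) =
    subst₂ (λ T′ W′ → Third T′ (tape [] □ []) W′ (tl ds))
      (sym (movedBase-blank T h)) (sym (movedOwn-blank T W h))
      (baseFirst {bs = []} ne [] p (stream-right W (head W) q))
    where
    h : isBlank (Vec.lookup (Vec.map head T) base) ≡ true
    h = cong isBlank (trans (Vec.lookup-map base head T) (stream-read (Vec.lookup T base) p))
  third-act true {T} {W = W} (baseFirst {bs = d ∷ bs} {ds} ne (isD ∷ digits) p q) =
    subst₂ (λ T′ W′ → Third T′ (tape [] □ []) W′ (bs ++ ds))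
      (sym (movedBase-nonblank T h)) (sym (movedOwn-nonblank T W h))
      (baseFirst ne digits
        (subst (Stream bs) (sym (Vec.lookup∘update base T _))
          (stream-right (Vec.lookup T base) (head (Vec.lookup T base)) p))
        q)
    where
    h : isBlank (Vec.lookup (Vec.map head T) base) ≡ false
    h = trans (cong isBlank (trans (Vec.lookup-map base head T) (stream-read (Vec.lookup T base) p))) (isBlank-digit isD)

  third-other : ∀ n {T B W rest ss} → Third T B W rest → Stream ss (Vec.lookup T ix) →
    Stream ss (Vec.lookup (movedBase n (head B) T) ix)
  third-other false           (ownOnly _)           s = s
  third-other true            (ownOnly _)           s = s
  third-other false           (baseFirst _ _ _ _)   s = s
  third-other true {T} {ss = ss} (baseFirst {bs = []} ne [] p q) s =
    subst (λ T′ → Stream ss (Vec.lookup T′ ix))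
      (sym (movedBase-blank T (cong isBlank (trans (Vec.lookup-map base head T) (stream-read (Vec.lookup T base) p))))) s
  third-other true {T} {ss = ss} (baseFirst {bs = d ∷ bs} ne (isD ∷ _) p q) s =
    subst (λ T′ → Stream ss (Vec.lookup T′ ix))
      (sym (movedBase-nonblank T
        (trans (cong isBlank (trans (Vec.lookup-map base head T) (stream-read (Vec.lookup T base) p))) (isBlank-digit isD))))
      (subst (Stream ss) (sym (Vec.lookup∘update′ (ne ∘ sym) T _)) s)

  third-update : ∀ {T B W rest} t → Third T B W rest → Third (T Vec.[ ix ]≔ t) B W rest
  third-update t (ownOnly s) = ownOnly s
  third-update {T} t (baseFirst {bs = bs} ne ds p q) =
    baseFirst ne ds (subst (Stream bs) (sym (Vec.lookup∘update′ ne T t)) p) q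

  module _ (V F D : Vec Tape m) (w : Vec Tape A.work) (O U : Tape) (es : List Symbol) where

    phase : P.State → Fin 6 → (T : Vec Tape m) (B W : Tape) (L : Vec Tape 9) (wP : Vec Tape P.work)
            (i₀ o₀ i₁ o₁ : Tape) → Tape → Conf
    phase p j T B W L wP i₀ o₀ i₁ o₁ o =
      inP p j ,
      (T ∷ V ∷ F ∷ D ∷ w ∷ (O ∷ W ∷ U ∷ B ∷ []) ∷ L ∷ wP ∷ (i₀ ∷ o₀ ∷ []) ∷ (i₁ ∷ o₁ ∷ []) ∷ []) ,
      o

    -- Every step of P adds at most one symbol to each pile and pouring a
    -- pile empties it, so φ, which bounds the piles, is the potential of
    -- an amortised linear time bound.
    data SimP (φ : ℕ) : Config P → Conf → Set where
      simP : ∀ {p T B W v₀ f₀ d₀ v₁ f₁ d₁ v₂ f₂ d₂ τ₀ τ₁ τ₂ wP i₀ o₀ i₁ o₁ ls h ss a₀ b₀ a₁ b₁ rest} →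
        Digits ss → Stream ss (Vec.lookup T ix) →
        Queue a₀ b₀ i₀ o₀ → Queue a₁ b₁ i₁ o₁ → Third T B W rest →
        Lazy (queued a₀ b₀ ss) v₀ f₀ d₀ τ₀ → Lazy (queued a₁ b₁ ss) v₁ f₁ d₁ τ₁ → Lazy rest v₂ f₂ d₂ τ₂ →
        length a₀ + length a₁ ≤ φ →
        SimP φ
          (config p (τ₀ ∷ τ₁ ∷ τ₂ ∷ wP) (tape ls h []))
          (phase p fetching T B W (v₀ ∷ f₀ ∷ d₀ ∷ v₁ ∷ f₁ ∷ d₁ ∷ v₂ ∷ f₂ ∷ d₂ ∷ []) wP i₀ o₀ i₁ o₁
            (tape (ls ++ es) h []))

    record Fetched (p : P.State) (T : Vec Tape m) (B W : Tape) (L : Vec Tape 9) (wP : Vec Tape P.work)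
                   (i₀ o₀ i₁ o₁ o : Tape) (ss a₀ b₀ a₁ b₁ rest : List Symbol) : Set where
      field
        {T′}       : Vec Tape m
        {i₀′ i₁′}  : Tape
        {ss′ a₀′ a₁′} : List Symbol
        moves      : next (phase p fetching T B W L wP i₀ o₀ i₁ o₁ o) ≡ phase p opening₀ T′ B W L wP i₀′ o₀ i₁′ o₁ o
        digits     : Digits ss′
        stream     : Stream ss′ (Vec.lookup T′ ix)
        queue₀     : Queue a₀′ b₀ i₀′ o₀
        queue₁     : Queue a₁′ b₁ i₁′ o₁
        third      : Third T′ B W rest
        unchanged₀ : a₀′ ʳ++ ss′ ≡ a₀ ʳ++ ss
        unchanged₁ : a₁′ ʳ++ ss′ ≡ a₁ ʳ++ ss
        exhausted₀ : a₀′ ≡ [] → ss′ ≡ []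
        exhausted₁ : a₁′ ≡ [] → ss′ ≡ []
        bound₀     : length a₀′ ≤ suc (length a₀)
        bound₁     : length a₁′ ≤ suc (length a₁)

    push : ∀ {a b i o} s → IsDigit s → Queue a b i o → Queue (s ∷ a) b (act (s , right) i) o
    push s isD q = record
      { Queue q; pile = pile-push s (Queue.pile q); pile-digits = isD ∷ Queue.pile-digits q }

    fetched : ∀ {p T B W L wP i₀ o₀ i₁ o₁ o ss a₀ b₀ a₁ b₁ rest} →
      Digits ss → Stream ss (Vec.lookup T ix) →
      Queue a₀ b₀ i₀ o₀ → Queue a₁ b₁ i₁ o₁ → Third T B W rest →
      Fetched p T B W L wP i₀ o₀ i₁ o₁ o ss a₀ b₀ a₁ b₁ rest
    fetched {p} {T} {B} {W} {L} {wP} {i₀} {o₀} {i₁} {o₁} {o} {[]} [] s q₀ q₁ third = record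
      { moves      = moves
      ; digits     = []
      ; stream     = s
      ; queue₀     = q₀
      ; queue₁     = q₁
      ; third      = third
      ; unchanged₀ = refl
      ; unchanged₁ = refl
      ; exhausted₀ = λ _ → refl
      ; exhausted₁ = λ _ → refl
      ; bound₀     = n≤1+n _
      ; bound₁     = n≤1+n _
      }
      where
      moves : next (phase p fetching T B W L wP i₀ o₀ i₁ o₁ o) ≡ phase p opening₀ T B W L wP i₀ o₀ i₁ o₁ o
      moves rewrite trans (Vec.lookup-map ix head T) (stream-read (Vec.lookup T ix) s) = refl
    fetched {p} {T} {B} {W} {L} {wP} {i₀} {o₀} {i₁} {o₁} {o} {d ∷ ss} (isD ∷ ds) s q₀ q₁ third = record
      { moves      = moves isD (trans (Vec.lookup-map ix head T) (stream-read (Vec.lookup T ix) s))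
      ; digits     = ds
      ; stream     = subst (Stream ss) (sym (Vec.lookup∘update ix T _))
                       (stream-right (Vec.lookup T ix) (head (Vec.lookup T ix)) s)
      ; queue₀     = push d isD q₀
      ; queue₁     = push d isD q₁
      ; third      = third-update (moveHead right (Vec.lookup T ix)) third
      ; unchanged₀ = refl
      ; unchanged₁ = refl
      ; exhausted₀ = λ ()
      ; exhausted₁ = λ ()
      ; bound₀     = ≤-refl
      ; bound₁     = ≤-refl
      }
      where
      moves : ∀ {d} → IsDigit d → Vec.lookup (Vec.map head T) ix ≡ d →
        next (phase p fetching T B W L wP i₀ o₀ i₁ o₁ o) ≡
        phase p opening₀ (T Vec.[ ix ]≔ moveHead right (Vec.lookup T ix)) B W L wP
          (act (d , right) i₀) o₀ (act (d , right) i₁) o₁ o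
      moves 𝟎 eq rewrite eq =
        cong (λ T′ → phase p opening₀ T′ B W L wP (act (𝟎 , right) i₀) o₀ (act (𝟎 , right) i₁) o₁ o) (poke-lookup ix right T)
      moves 𝟏 eq rewrite eq =
        cong (λ T′ → phase p opening₀ T′ B W L wP (act (𝟏 , right) i₀) o₀ (act (𝟏 , right) i₁) o₁ o) (poke-lookup ix right T)

    module _ (p : P.State) (T : Vec Tape m) (B W : Tape) (L : Vec Tape 9) (wP : Vec Tape P.work) (i o t : Tape) where

      transfer₀ : Transfer next halted
        (λ i₀ o₀ → phase p opening₀ T B W L wP i₀ o₀ i o t)
        (λ i₀ o₀ → phase p pouring₀ T B W L wP i₀ o₀ i o t)
        (λ i₀ o₀ → phase p opening₁ T B W L wP i₀ o₀ i o t)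
      transfer₀ = record
        { opening-on = λ _ _ → refl
        ; pouring-on = λ _ _ → refl
        ; opens      = λ { _ (tape _ □ _) refl → refl }
        ; skips      = λ { _ (tape _ 𝟎 _) 𝟎 → refl ; _ (tape _ 𝟏 _) 𝟏 → refl }
        ; pours      = λ { (tape _ 𝟎 _) _ 𝟎 → refl ; (tape _ 𝟏 _) _ 𝟏 → refl }
        ; closes     = λ { (tape _ □ _) _ refl → refl }
        }

      transfer₁ : Transfer next halted
        (λ i₁ o₁ → phase p opening₁ T B W L wP i o i₁ o₁ t)
        (λ i₁ o₁ → phase p pouring₁ T B W L wP i o i₁ o₁ t)
        (λ i₁ o₁ → phase p going T B W L wP i o i₁ o₁ t)
      transfer₁ = record
        { opening-on = λ _ _ → refl
        ; pouring-on = λ _ _ → refl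
        ; opens      = λ { _ (tape _ □ _) refl → refl }
        ; skips      = λ { _ (tape _ 𝟎 _) 𝟎 → refl ; _ (tape _ 𝟏 _) 𝟏 → refl }
        ; pours      = λ { (tape _ 𝟎 _) _ 𝟎 → refl ; (tape _ 𝟏 _) _ 𝟏 → refl }
        ; closes     = λ { (tape _ □ _) _ refl → refl }
        }

    -- The value of `P.δ` enters through an equation because the symbols passed to it equal the
    -- heads of the tapes of `P` only by the reading lemmas, not by computation.
    going-next : ∀ {p T B W v₀ f₀ d₀ v₁ f₁ d₁ v₂ f₂ d₂ wP i₀ o₀ i₁ o₁ o p′ x₀ x₁ x₂ xs a} →
      P.δ p
        (virtual (head o₀) (head v₀) (head f₀) (head d₀) ∷ virtual (head o₁) (head v₁) (head f₁) (head d₁) ∷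
         virtual (thirdSymbol (head B) (Vec.lookup (Vec.map head T) base) (head W)) (head v₂) (head f₂) (head d₂) ∷
         Vec.map head wP) (head o)
        ≡ (p′ , (x₀ ∷ x₁ ∷ x₂ ∷ xs) , a) →
      next (phase p going T B W (v₀ ∷ f₀ ∷ d₀ ∷ v₁ ∷ f₁ ∷ d₁ ∷ v₂ ∷ f₂ ∷ d₂ ∷ []) wP i₀ o₀ i₁ o₁ o) ≡
      phase p′ fetching
        (movedBase (need (head f₂) (head d₂)) (head B) T) B (movedOwn (need (head f₂) (head d₂)) (head B) T W)
        (act x₀ v₀ ∷ act (visit x₀) f₀ ∷ act (turn x₀) d₀ ∷
         act x₁ v₁ ∷ act (visit x₁) f₁ ∷ act (turn x₁) d₁ ∷
         act x₂ v₂ ∷ act (visit x₂) f₂ ∷ act (turn x₂) d₂ ∷ [])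
        (Vec.zipWith act xs wP)
        i₀ (act (popAction (need (head f₀) (head d₀)) (head o₀)) o₀)
        i₁ (act (popAction (need (head f₁) (head d₁)) (head o₁)) o₁)
        (act (proj₁ a , toMove (proj₂ a)) o)
    going-next eq rewrite eq = refl

    simP-output : ∀ {φ p T B W v₀ f₀ d₀ v₁ f₁ d₁ v₂ f₂ d₂ τ₀ τ₁ τ₂ wP i₀ o₀ i₁ o₁ ls h ss a₀ b₀ a₁ b₁ rest} s d →
      Digits ss → Stream ss (Vec.lookup T ix) →
      Queue a₀ b₀ i₀ o₀ → Queue a₁ b₁ i₁ o₁ → Third T B W rest →
      Lazy (queued a₀ b₀ ss) v₀ f₀ d₀ τ₀ → Lazy (queued a₁ b₁ ss) v₁ f₁ d₁ τ₁ → Lazy rest v₂ f₂ d₂ τ₂ →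
      length a₀ + length a₁ ≤ φ →
      SimP φ
        (config p (τ₀ ∷ τ₁ ∷ τ₂ ∷ wP) (act (s , toMove d) (tape ls h [])))
        (phase p fetching T B W (v₀ ∷ f₀ ∷ d₀ ∷ v₁ ∷ f₁ ∷ d₁ ∷ v₂ ∷ f₂ ∷ d₂ ∷ []) wP i₀ o₀ i₁ o₁
          (act (s , toMove d) (tape (ls ++ es) h [])))
    simP-output s stay  = simP
    simP-output s right = simP

    going-sim : ∀ {φ p T B W v₀ f₀ d₀ v₁ f₁ d₁ v₂ f₂ d₂ τ₀ τ₁ τ₂ wP i₀ o₀ i₁ o₁ ls h ss a₀ b₀ a₁ b₁ rest} →
      Digits ss → Stream ss (Vec.lookup T ix) →
      Queue a₀ b₀ i₀ o₀ → (b₀ ≡ [] → a₀ ʳ++ ss ≡ []) →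
      Queue a₁ b₁ i₁ o₁ → (b₁ ≡ [] → a₁ ʳ++ ss ≡ []) →
      Third T B W rest →
      Lazy (queued a₀ b₀ ss) v₀ f₀ d₀ τ₀ → Lazy (queued a₁ b₁ ss) v₁ f₁ d₁ τ₁ → Lazy rest v₂ f₂ d₂ τ₂ →
      length a₀ + length a₁ ≤ φ →
      SimP φ (step P (config p (τ₀ ∷ τ₁ ∷ τ₂ ∷ wP) (tape ls h [])))
        (next (phase p going T B W (v₀ ∷ f₀ ∷ d₀ ∷ v₁ ∷ f₁ ∷ d₁ ∷ v₂ ∷ f₂ ∷ d₂ ∷ []) wP i₀ o₀ i₁ o₁ (tape (ls ++ es) h [])))
    going-sim {φ} {p} {T} {B} {W} {v₀} {f₀} {d₀} {v₁} {f₁} {d₁} {v₂} {f₂} {d₂} {τ₀} {τ₁} {τ₂} {wP} {i₀} {o₀} {i₁} {o₁} {ls} {h} {ss}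
      ds s q₀ ready₀ q₁ ready₁ th l₀ l₁ l₂ le
      with P.δ p (head τ₀ ∷ head τ₁ ∷ head τ₂ ∷ Vec.map head wP) h in eq
    ... | p′ , (x₀ ∷ x₁ ∷ x₂ ∷ xs) , (x , d)
      with pop (need (head f₀) (head d₀)) q₀ ready₀ | pop (need (head f₁) (head d₁)) q₁ ready₁
    ... | b₀′ , q₀′ , e₀ | b₁′ , q₁′ , e₁ =
      subst (SimP φ _) (sym moves)
        (simP-output {h = h} x d ds (third-other n₂ th s) q₀′ q₁′ (third-act n₂ th)
          (subst (λ r → Lazy r _ _ _ _) e₀ (lazy-act l₀ x₀))
          (subst (λ r → Lazy r _ _ _ _) e₁ (lazy-act l₁ x₁))
          (lazy-act l₂ x₂) le)
      where
      n₂ = need (head f₂) (head d₂)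
      moves = going-next {p} {T} {B} {W} {v₀} {f₀} {d₀} {v₁} {f₁} {d₁} {v₂} {f₂} {d₂} {wP} {i₀} {o₀} {i₁} {o₁} {tape (ls ++ es) h []}
        (trans (cong₂ (λ y (z : Symbol × Symbol) → P.δ p (y ∷ proj₁ z ∷ proj₂ z ∷ Vec.map head wP) h)
          (trans (cong (λ y → virtual y (head v₀) (head f₀) (head d₀)) (queue-read ss q₀ ready₀)) (lazy-read l₀))
          (cong₂ _,_
            (trans (cong (λ y → virtual y (head v₁) (head f₁) (head d₁)) (queue-read ss q₁ ready₁)) (lazy-read l₁))
            (trans (cong (λ y → virtual y (head v₂) (head f₂) (head d₂)) (third-read th)) (lazy-read l₂))))
          eq)

    record SteppedP (φ : ℕ) (c : Config P) (k : Conf) : Set where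
      field
        {k′}  : Conf
        time  : ℕ
        rest  : ℕ
        run   : Run next halted k time k′
        bound : time + rest ≤ 8 + φ
        sim   : SimP rest (step P c) k′

    -- The 8 consists of one fetching step, one step of `P`, and for each queue two steps of
    -- overhead in opening it and one for the digit just pushed.
    step-bound : ∀ t₀ t₁ {r₀ r₁ a₀ a₁ b₀ b₁ φ} → t₀ + r₀ ≤ 2 + a₀ → t₁ + r₁ ≤ 2 + a₁ →
      a₀ ≤ suc b₀ → a₁ ≤ suc b₁ → b₀ + b₁ ≤ φ → 1 + (t₀ + (t₁ + 1)) + (r₀ + r₁) ≤ 8 + φ
    step-bound t₀ t₁ {r₀} {r₁} {a₀} {a₁} {b₀} {b₁} {φ} p₀ p₁ q₀ q₁ le = begin
      1 + (t₀ + (t₁ + 1)) + (r₀ + r₁)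
        ≡⟨ solve 4 (λ t₀ t₁ r₀ r₁ → con 1 :+ (t₀ :+ (t₁ :+ con 1)) :+ (r₀ :+ r₁) :=
             con 2 :+ ((t₀ :+ r₀) :+ (t₁ :+ r₁))) refl t₀ t₁ r₀ r₁ ⟩
      2 + ((t₀ + r₀) + (t₁ + r₁))
        ≤⟨ +-monoʳ-≤ 2 (+-mono-≤ (≤-trans p₀ (+-monoʳ-≤ 2 q₀)) (≤-trans p₁ (+-monoʳ-≤ 2 q₁))) ⟩
      2 + ((2 + suc b₀) + (2 + suc b₁))
        ≡⟨ solve 2 (λ b₀ b₁ → con 2 :+ ((con 3 :+ b₀) :+ (con 3 :+ b₁)) := con 8 :+ (b₀ :+ b₁)) refl b₀ b₁ ⟩
      8 + (b₀ + b₁)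
        ≤⟨ +-monoʳ-≤ 8 le ⟩
      8 + φ ∎
      where
      open ≤-Reasoning
      open +-*-Solver

    simP-step : ∀ {φ c k} → P.halting (state c) ≡ false → SimP φ c k → SteppedP φ c k
    simP-step {φ} {k = k} hp (simP {p} {T} {B} {W} {v₀} {f₀} {d₀} {v₁} {f₁} {d₁} {v₂} {f₂} {d₂} {τ₀} {τ₁} {τ₂} {wP} {i₀} {o₀} {i₁} {o₁} {ls} {h} {ss} {a₀} {b₀} {a₁} {b₁}
      ds s q₀ q₁ th l₀ l₁ l₂ le) = record
      { time  = 1 + (O₀.time + (O₁.time + 1))
      ; rest  = length O₀.a′ + length O₁.a′
      ; run   = tick′ hp F.moves (O₀.run ◅◅ O₁.run ◅◅ tick refl done)
      ; bound = step-bound O₀.time O₁.time O₀.bound O₁.bound F.bound₀ F.bound₁ le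
      ; sim   = going-sim F.digits F.stream
          O₀.queue (λ e → cong₂ _ʳ++_ (proj₂ (O₀.exhausted e)) (F.exhausted₀ (proj₁ (O₀.exhausted e))))
          O₁.queue (λ e → cong₂ _ʳ++_ (proj₂ (O₁.exhausted e)) (F.exhausted₁ (proj₁ (O₁.exhausted e))))
          F.third
          (subst (λ r → Lazy r _ _ _ _) (trans (cong (b₀ ++_) (sym F.unchanged₀)) (sym (O₀.unchanged F.ss′))) l₀)
          (subst (λ r → Lazy r _ _ _ _) (trans (cong (b₁ ++_) (sym F.unchanged₁)) (sym (O₁.unchanged F.ss′))) l₁)
          l₂ ≤-refl
      }
      where
      L = v₀ ∷ f₀ ∷ d₀ ∷ v₁ ∷ f₁ ∷ d₁ ∷ v₂ ∷ f₂ ∷ d₂ ∷ []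
      o = tape (ls ++ es) h []
      module F = Fetched (fetched {p} {T} {B} {W} {L} {wP} {i₀} {o₀} {i₁} {o₁} {o} ds s q₀ q₁ th)
      module M₀ = Pouring (transfer₀ p F.T′ B W L wP F.i₁′ o₁ o)
      module O₀ = M₀.Opened (M₀.open-run F.queue₀)
      module M₁ = Pouring (transfer₁ p F.T′ B W L wP O₀.i′ O₀.o′ o)
      module O₁ = M₁.Opened (M₁.open-run F.queue₁)

    simP-run : ∀ {φ c t c′ k} → Steps P c t c′ → SimP φ c k →
      Reaches k (8 * t + φ) (λ k′ → ∃[ φ′ ] SimP φ′ c′ k′)
    simP-run done s = 0 , _ , done , z≤n , _ , s
    simP-run {φ} {t = suc t} (tick h r) s =
      let module S = SteppedP (simP-step h s)
          t′ , k′ , r′ , le , s′ = simP-run r S.sim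
      in S.time + t′ , k′ , S.run ◅◅ r′ ,
         (begin
           S.time + t′                 ≤⟨ +-monoʳ-≤ S.time le ⟩
           S.time + (8 * t + S.rest)   ≡⟨ solve 3 (λ a b c → a :+ (b :+ c) := b :+ (a :+ c)) refl S.time (8 * t) S.rest ⟩
           8 * t + (S.time + S.rest)   ≤⟨ +-monoʳ-≤ (8 * t) S.bound ⟩
           8 * t + (8 + φ)             ≡⟨ solve 2 (λ t φ → con 8 :* t :+ (con 8 :+ φ) := con 8 :* (con 1 :+ t) :+ φ) refl t φ ⟩
           8 * suc t + φ               ∎) ,
         s′
      where
      open ≤-Reasoning
      open +-*-Solver

-- The complete run and its time bound

module Sequence {m : ℕ} (A : Machine m) (P : Machine 3) (ix base : Fin m) where

  open Composition A P ix base
  open FirstPhase A P ix base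
  open SecondPhase A P ix base
  private
    module A = Machine A
    module P = Machine P

  -- The result of A consists of the digits that A wrote at the right of
  -- its last ♯, or at the right of the old result if it wrote no ♯.
  data Result (bo : List Symbol) (r y : ℕ) (X : List Symbol) (h : Symbol) : Set where
    fresh    : mark X ≡ 𝟏 → scan (h ∷ X ++ ♯ ∷ []) ʳ++ [] ≡ numeral y → Result bo r y X h
    appended : mark X ≡ □ → base ≢ ix → bo ≡ reverse (♯ ∷ numeral r) →
               numeral r ++ (scan (h ∷ X ++ ♯ ∷ []) ʳ++ []) ≡ numeral y → Result bo r y X h

  -- The output tape at the start is either empty, as for a machine on its input, or `resultTape` of
  -- the number on the tape `base`, as for a machine that turns results.
  Old : List Symbol → ℕ → Set
  Old bo r = bo ≡ [] ⊎ (base ≢ ix × bo ≡ reverse (♯ ∷ numeral r))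

  read-result : ∀ {bo r y X h} → Old bo r → tape (X ++ bo) h [] Shows y → Result bo r y X h
  read-result {bo} {r} {y} {X} {h} old p = cases (mark-cases X) old
    where
    scanned : scan (h ∷ X ++ bo) ≡ reverse (numeral y)
    scanned = trans (cong scan (sym (reverse-content (X ++ bo) h))) (shows-scan p)

    -- The register ignores the cell under the head. A ♯ there would leave an empty result, and
    -- numerals are not empty.
    h≢♯ : h ≢ ♯
    h≢♯ refl = numeral-nonempty y (reverse-injective (sym scanned))

    marked : ∀ {b} → mark X ≡ b → mark (h ∷ X) ≡ b
    marked = go h h≢♯
      where
      go : ∀ h {b} → h ≢ ♯ → mark X ≡ b → mark (h ∷ X) ≡ b
      go 𝟎 ne e = e
      go 𝟏 ne e = e
      go ♯ ne e = contradiction refl ne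
      go □ ne e = e

    cases : mark X ≡ 𝟏 ⊎ mark X ≡ □ → Old bo r → Result bo r y X h
    cases (inj₁ e) _ = fresh e
      (trans (cong reverse (trans (scan-marked (h ∷ X) (♯ ∷ []) bo (marked e)) scanned)) (reverse-involutive (numeral y)))
    -- On an initially empty output tape nothing is shown until `A` writes ♯.
    cases (inj₂ e) (inj₁ refl) = contradiction
      (trans (sym (marked e))
        (trans (cong (λ xs → mark (h ∷ xs)) (sym (++-identityʳ X)))
          (trans (cong mark (sym (reverse-content (X ++ []) h))) (shows-mark p))))
      λ ()
    cases (inj₂ e) (inj₂ (ne , refl)) = appended e ne refl (begin
      numeral r ++ reverse S
        ≡⟨ cong (_++ reverse S) (sym (reverse-involutive (numeral r))) ⟩
      reverse (reverse (numeral r)) ++ reverse S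
        ≡⟨ sym (reverse-++ S (reverse (numeral r))) ⟩
      reverse (S ++ reverse (numeral r))
        ≡⟨ cong (λ ds → reverse (S ++ ds)) (sym (scan-old r)) ⟩
      reverse (S ++ scan (reverse (♯ ∷ numeral r)))
        ≡⟨ cong reverse (sym (scan-unmarked (h ∷ X) _ (marked e))) ⟩
      reverse (scan (h ∷ X ++ reverse (♯ ∷ numeral r)))
        ≡⟨ cong reverse scanned ⟩
      reverse (reverse (numeral y))
        ≡⟨ reverse-involutive (numeral y) ⟩
      numeral y ∎)
      where
      open ≡-Reasoning
      S = scan (h ∷ X ++ ♯ ∷ [])
      scan-old : ∀ r → scan (reverse (♯ ∷ numeral r)) ≡ reverse (numeral r)
      scan-old r = trans (cong scan (unfold-reverse ♯ (numeral r)))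
        (trans (scan-digits++ (reverse-digits (numeral-digits r)) (♯ ∷ [])) (++-identityʳ _))

  stream-source : ∀ rc rest → Stream rest (tape rc (hd rest) (tl rest))
  stream-source rc []         = pad (□∷ [])
  stream-source rc (d ∷ rest) = unpadded (d ∷ rest)

  record Rewind (N : ℕ) (ds : List Symbol) (t : Tape) : Set where
    field
      read rest : List Symbol
      position  : Rewindable read rest t
      whole     : read ʳ++ rest ≡ ds
      short     : length read ≤ N

  rewind-source : ∀ {N ds rest t} → Source N ds rest t → Rewind N ds t
  rewind-source {rest = rest} (source {read} rd _ eq le) = record
    { position = rewindable rd (unpadded read) (stream-source read rest) ; whole = eq ; short = le }

  rewind-inputs : ∀ {N} {xs : Vec ℕ m} {T V F D τ} → Inputs N xs T V F D τ → ∀ k → Rewind N (numeral (Vec.lookup xs k)) (Vec.lookup T k)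
  rewind-inputs i k = rewind-source (proj₂ (inputs-source i k))

  weaken : ∀ {c b b′ Q} → b ≤ b′ → Reaches c b Q → Reaches c b′ Q
  weaken le (t , c′ , r , le′ , q) = t , c′ , r , ≤-trans le′ le , q

  rewound : ∀ {ds t} → Rewindable [] ds t → Stream ds t
  rewound (rewindable _ _ s) = s

  module _ (V F D : Vec Tape m) (w : Vec Tape A.work) (O W U B : Tape)
           (L : Vec Tape 9) (wP : Vec Tape P.work) (i₀ o₀ i₁ o₁ : Tape) (o : Tape) where

    private
      G : Store sizes Tape
      G = V ∷ F ∷ D ∷ w ∷ (O ∷ W ∷ U ∷ B ∷ []) ∷ L ∷ wP ∷ (i₀ ∷ o₀ ∷ []) ∷ (i₁ ∷ o₁ ∷ []) ∷ []

      rewinding : Fin m → (back exit : Control) → Vec Tape m → Conf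
      rewinding k back exit T =
        proj₁ (rewind k back exit (Vec.map head T)) , apply (proj₂ (rewind k back exit (Vec.map head T))) (T ∷ G) , o

      turns : ∀ k {back exit} T →
        isBlank (Vec.lookup (Vec.map head T) k) ≡ true →
        rewinding k back exit T ≡
        (exit , Vec.zipWith act (poke k right (Vec.map head T)) T ∷ G , o)
      turns k T h rewrite h = refl

      backs : ∀ k {back exit} T →
        isBlank (Vec.lookup (Vec.map head T) k) ≡ false →
        rewinding k back exit T ≡
        (back , Vec.zipWith act (poke k left (Vec.map head T)) T ∷ G , o)
      backs k T h rewrite h = refl

      rewind₀ : ∀ T {read rest} → Rewindable read rest (Vec.lookup T ix) →
        Reaches (seeking₀ , T ∷ G , o) (2 + length read)
          (λ c → ∃[ t ] (c ≡ (seeking₁ , (T Vec.[ ix ]≔ t) ∷ G , o) × Rewindable [] (read ʳ++ rest) t))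
      rewind₀ T = rewind-reaches ix {seeking₀} {backing₀} {seeking₁} G o (λ _ → refl) (turns ix {backing₀}) (backs ix {exit = seeking₁}) refl refl T

      rewind₁ : ∀ T {read rest} → Rewindable read rest (Vec.lookup T base) →
        Reaches (seeking₁ , T ∷ G , o) (2 + length read)
          (λ c → ∃[ t ] (c ≡ (inP P.start fetching , (T Vec.[ base ]≔ t) ∷ G , o) × Rewindable [] (read ʳ++ rest) t))
      rewind₁ T = rewind-reaches base {seeking₁} {backing₁} {inP P.start fetching} G o (λ _ → refl) (turns base {backing₁}) (backs base {exit = inP P.start fetching}) refl refl T

    rewind-both : ∀ {N xs T} → (∀ k → Rewind N (numeral (Vec.lookup xs k)) (Vec.lookup T k)) →
      Reaches (seeking₀ , T ∷ G , o) ((2 + N) + ((2 + N) + 0))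
        (λ c → ∃[ T′ ] (c ≡ (inP P.start fetching , T′ ∷ G , o) ×
          Stream (numeral (Vec.lookup xs ix)) (Vec.lookup T′ ix) ×
          Stream (numeral (Vec.lookup xs base)) (Vec.lookup T′ base)))
    rewind-both {N} {xs} {T} rw =
      weaken (+-monoʳ-≤ 2 (Rewind.short (rw ix))) (rewind₀ T (Rewind.position (rw ix))) >>= λ where
        (t , refl , s) →
          let s′ = subst (λ ds → Rewindable [] ds t) (Rewind.whole (rw ix)) s
              T′ = T Vec.[ ix ]≔ t
              rw′ = again s′ (base Fin.≟ ix)
          in weaken (+-monoʳ-≤ 2 (Rewind.short rw′)) (rewind₁ T′ (Rewind.position rw′)) >>= λ where
            (t′ , refl , s₁) →
              let s₁′ = subst (λ ds → Rewindable [] ds t′) (Rewind.whole rw′) s₁ in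
              0 , _ , done , z≤n , T′ Vec.[ base ]≔ t′ , refl , first s′ s₁′ (base Fin.≟ ix) ,
              subst (Stream _) (sym (Vec.lookup∘update base T′ t′)) (rewound s₁′)
      where
      -- If `base` and `ix` are the same tape, the second rewinding finds it rewound, with no digit
      -- read.
      again : ∀ {t} → Rewindable [] (numeral (Vec.lookup xs ix)) t → Dec (base ≡ ix) →
        Rewind N (numeral (Vec.lookup xs base)) (Vec.lookup (T Vec.[ ix ]≔ t) base)
      again {t} s (yes refl) = record
        { position = subst (Rewindable [] _) (sym (Vec.lookup∘update ix T t)) s ; whole = refl ; short = z≤n }
      again {t} s (no ne) = subst (Rewind N _) (sym (Vec.lookup∘update′ ne T t)) (rw base)
      first : ∀ {t t′} → Rewindable [] (numeral (Vec.lookup xs ix)) t → Rewindable [] (numeral (Vec.lookup xs base)) t′ →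
        Dec (base ≡ ix) → Stream (numeral (Vec.lookup xs ix)) (Vec.lookup ((T Vec.[ ix ]≔ t) Vec.[ base ]≔ t′) ix)
      first {t} {t′} s s′ (yes refl) = subst (Stream _) (sym (Vec.lookup∘update ix (T Vec.[ ix ]≔ t) t′)) (rewound s′)
      first {t} {t′} s s′ (no ne) =
        subst (Stream _) (sym (trans (Vec.lookup∘update′ (ne ∘ sym) (T Vec.[ ix ]≔ t) t′) (Vec.lookup∘update ix T t))) (rewound s)

  Final : ℕ → Conf → Set
  Final z c = halted c ≡ true × proj₂ (proj₂ c) Shows z

  simP-final : ∀ {V F D w O U es φ z c k} → SimP V F D w O U es φ c k →
    P.halting (state c) ≡ true → output c Shows z → Final z k
  simP-final {es = es} (simP _ _ _ _ _ _ _ _ _) h p = h , shows-++ es p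

  empty-queue : Queue [] [] blank blank
  empty-queue = record
    { pile = refl , pad [] , [] ; pile-digits = [] ; stack = pad (□∷ []) , [] ; stack-digits = [] }

  module _ (xs : Vec ℕ m) {y z tP : ℕ} {c′ : Config P}
           (runP : Steps P (initial P (Vec.lookup xs ix ∷ Vec.lookup xs ix ∷ y ∷ []) (resultTape y)) tP c′)
           (haltP : P.halting (state c′) ≡ true) (showsP : output c′ Shows z) where

    -- Fresh and appended results differ only in how the third input is assembled (`third`) and in
    -- what lies at the left of the new result (`es`); from here on they are treated alike.
    copying-final : ∀ {N T} V F D w O b {ds os} es →
      (∀ k → Rewind N (numeral (Vec.lookup xs k)) (Vec.lookup T k)) →
      Digits ds →
      (∀ T′ → Stream (numeral (Vec.lookup xs base)) (Vec.lookup T′ base) →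
        Third T′ (tape [] b []) (tape (□ ∷ []) (hd ds) (tl ds)) (numeral y)) →
      ds ʳ++ os ≡ reverse (♯ ∷ numeral y) ++ es →
      Reaches
        (copying ,
         (T ∷ V ∷ F ∷ D ∷ w ∷ (O ∷ tape (□ ∷ []) (hd ds) (tl ds) ∷ tape (□ ∷ []) (hd ds) (tl ds) ∷ tape [] b [] ∷ []) ∷
          blanks (9 ∷ P.work ∷ 2 ∷ 2 ∷ [])) ,
         tape os □ [])
        (suc (length ds) + (((2 + N) + ((2 + N) + 0)) + (8 * tP + 0 + 0)))
        (Final z)
    copying-final {N} {T} V F D w O b {ds} {os} es rw digits third out =
      copy-reaches T V F D w _ _ _ _ digits (□ ∷ []) O (tape (□ ∷ []) (hd ds) (tl ds)) (tape [] b []) os >>= λ where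
        (U , refl) →
          rewind-both V F D w O (tape (□ ∷ []) (hd ds) (tl ds)) U (tape [] b []) (Vec.replicate 9 blank) (Vec.replicate P.work blank) blank blank blank blank (tape (ds ʳ++ os) □ []) {xs = xs} rw >>= λ where
            (T′ , refl , sᵢ , sᵦ) →
              simP-run V F D w O U es runP (start T′ U sᵢ (third T′ sᵦ)) >>= λ where
                (φ , s) → 0 , _ , done , z≤n , simP-final s haltP showsP
      where
      i = Vec.lookup xs ix
      start : ∀ T′ U → Stream (numeral i) (Vec.lookup T′ ix) →
        Third T′ (tape [] b []) (tape (□ ∷ []) (hd ds) (tl ds)) (numeral y) →
        SimP V F D w O U es 0
          (initial P (i ∷ i ∷ y ∷ []) (resultTape y))
          (inP P.start fetching ,
           (T′ ∷ V ∷ F ∷ D ∷ w ∷ (O ∷ tape (□ ∷ []) (hd ds) (tl ds) ∷ U ∷ tape [] b [] ∷ []) ∷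
            blanks (9 ∷ P.work ∷ 2 ∷ 2 ∷ [])) ,
           tape (ds ʳ++ os) □ [])
      start T′ U s th rewrite out =
        simP (numeral-digits i) s empty-queue empty-queue th (lazy-initial i) (lazy-initial i) (lazy-initial y) z≤n

    halted-next : ∀ {q T V F D w O W U B L wP Q₀ Q₁ o} → A.halting q ≡ true →
      next (inA q , (T ∷ V ∷ F ∷ D ∷ w ∷ (O ∷ W ∷ U ∷ B ∷ []) ∷ L ∷ wP ∷ Q₀ ∷ Q₁ ∷ []) , o) ≡
      result T V F D w L wP Q₀ Q₁ scanning O W U B o
    halted-next h rewrite h = refl

    simA-final : ∀ {bo N c k} → Old bo (Vec.lookup xs base) → SimA xs (tape bo □ []) N c k →
      A.halting (state c) ≡ true → output c Shows y →
      Reaches k (10 + (4 * N + 8 * tP)) (Final z)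
    simA-final {bo} {N} old (simA {T} {V} {F} {D} {τ} {w} {q} {h} X i le) hA shown =
      weaken bound
        (tick-reaches _ refl (halted-next hA)
          (scan-reaches T V F D w _ _ _ _ (h ∷ X) [] [] (tape [] (mark X) []) (tape bo □ []) >>= λ where
            (O , refl) → continue (mark X) refl O (read-result old shown)))
      where
      S = scan (h ∷ X ++ ♯ ∷ [])
      ds = S ʳ++ []
      digits : Digits ds
      digits = ʳ++-digits (scan-digits (h ∷ X ++ ♯ ∷ [])) []
      W = tape (□ ∷ []) (hd ds) (tl ds)
      continue : ∀ b → mark X ≡ b → ∀ O → Result bo (Vec.lookup xs base) y X h →
        Reaches (result T V F D w _ _ _ _ copying O W W (tape [] b []) (announced b (tape bo □ [])))
        (suc (length ds) + (((2 + N) + ((2 + N) + 0)) + (8 * tP + 0 + 0))) (Final z)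
      continue b e O (fresh e′ w≡) with trans (sym e) e′
      ... | refl = copying-final V F D w O 𝟏 bo (rewind-inputs i) digits
        (λ T′ _ → subst (Third T′ (tape [] 𝟏 []) W) w≡ (ownOnly (stream-source (□ ∷ []) ds)))
        (trans (cong (_ʳ++ ♯ ∷ bo) w≡) (sym (ʳ++-assoc (numeral y))))
      continue b e O (appended e′ ne refl w≡) with trans (sym e) e′
      ... | refl = copying-final V F D w O □ [] (rewind-inputs i) digits
        (λ T′ s → subst (Third T′ (tape [] □ []) W) w≡
          (baseFirst ne (numeral-digits (Vec.lookup xs base)) s (stream-source (□ ∷ []) ds)))
        (trans (sym (++-ʳ++ (numeral (Vec.lookup xs base)))) (trans (cong (_ʳ++ ♯ ∷ []) w≡) (sym (++-identityʳ _))))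
      -- Scanning, copying and the two rewindings each contribute one `N`.
      bound : suc (suc (suc (length X)) + (suc (length ds) + (((2 + N) + ((2 + N) + 0)) + (8 * tP + 0 + 0)))) ≤ 10 + (4 * N + 8 * tP)
      bound = begin
        suc (suc (suc (length X)) + (suc (length ds) + (((2 + N) + ((2 + N) + 0)) + (8 * tP + 0 + 0))))
          ≤⟨ s≤s (+-mono-≤ (s≤s (s≤s le)) (+-monoˡ-≤ _ (s≤s short))) ⟩
        suc (suc (suc N) + (suc (2 + N) + (((2 + N) + ((2 + N) + 0)) + (8 * tP + 0 + 0))))
          ≡⟨ solve 2 (λ n p → con 1 :+ ((con 2 :+ n) :+ ((con 3 :+ n) :+ (((con 2 :+ n) :+ ((con 2 :+ n) :+ con 0)) :+ (con 8 :* p :+ con 0 :+ con 0)))) :=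
               con 10 :+ (con 4 :* n :+ con 8 :* p)) refl N tP ⟩
        10 + (4 * N + 8 * tP) ∎
        where
        open ≤-Reasoning
        open +-*-Solver
        short : length ds ≤ 2 + N
        short = begin
          length ds                  ≡⟨ trans (length-ʳ++ S) (+-identityʳ _) ⟩
          length S                   ≤⟨ length-scan (h ∷ X ++ ♯ ∷ []) ⟩
          suc (length (X ++ ♯ ∷ [])) ≡⟨ cong suc (trans (length-++ X) (+-comm (length X) 1)) ⟩
          2 + length X               ≤⟨ s≤s (s≤s le) ⟩
          2 + N                      ∎

  -- No length of a number enters the bound: every auxiliary pass is over cells that `A` has written
  -- on the output or digits that it has fetched.
  sequence : ∀ xs {bo y z b t} → Old bo (Vec.lookup xs base) →
    HaltsAfter A t (initial A xs (tape bo □ [])) →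
    output (iterate (step A) (initial A xs (tape bo □ [])) t) Shows y →
    P Turns (Vec.lookup xs ix , Vec.lookup xs ix , y) To z Within b →
    ∃[ t′ ] (t′ ≤ 12 * (t + b + 1) × HaltsAfter machine t′ (initial machine xs (tape bo □ [])) ×
      output (iterate (step machine) (initial machine xs (tape bo □ [])) t′) Shows z)
  sequence xs {bo} {y} {z} {b} {t} old (haltA , before-haltA) showsA (tP , tP≤b , (haltP , before-haltP) , showsP) =
    let k , r , s = simA-run (iterate-run t (initial A xs (tape bo □ [])) before-haltA) (simA [] (inputs-initial xs) z≤n)
        t′ , k′ , r′ , le , (h , shown) = simA-final xs (iterate-run tP _ before-haltP) haltP showsP old s haltA showsA
        run = tick′ {c = setup , Vec.map inputTape xs ∷ blanks sizes , tape bo □ []} refl refl (r ◅◅ r′)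
        run′ = subst (λ c → Steps machine c (suc (t + t′)) (flat k′)) (sym (initial-flat xs (tape bo □ []))) (run-flat run)
    in suc (t + t′) , bound t′ le ,
       (trans (cong (halting ∘ state) (run-iterate run′)) h , run-before run′) ,
       subst (λ c → output c Shows z) (sym (run-iterate run′)) shown
    where
    -- The run of `A` adds one `t` to the four of the passes after it; 12 is a common bound for the
    -- coefficients 5 and 8 and the constant.
    bound : ∀ t′ → t′ ≤ 10 + (4 * (t + 0) + 8 * tP) → suc (t + t′) ≤ 12 * (t + b + 1)
    bound t′ le = begin
      suc (t + t′)            ≤⟨ s≤s (+-monoʳ-≤ t le) ⟩
      suc (t + (10 + (4 * (t + 0) + 8 * tP)))
        ≡⟨ solve 2 (λ t p → con 1 :+ (t :+ (con 10 :+ (con 4 :* (t :+ con 0) :+ con 8 :* p))) :=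
             con 5 :* t :+ con 8 :* p :+ con 11) refl t tP ⟩
      5 * t + 8 * tP + 11
        ≤⟨ +-mono-≤ (+-mono-≤ (*-monoˡ-≤ t (m≤m+n 5 7)) (*-mono-≤ (m≤m+n 8 4) tP≤b)) (n≤1+n 11) ⟩
      12 * t + 12 * b + 12    ≡⟨ solve 2 (λ t b → con 12 :* t :+ con 12 :* b :+ con 12 := con 12 :* (t :+ b :+ con 1)) refl t b ⟩
      12 * (t + b + 1)        ∎
      where
      open ≤-Reasoning
      open +-*-Solver

-- Orders of growth

_≲_ : (a b : (n : ℕ) → .{{NonZero n}} → ℕ) → Set
a ≲ b = ∃[ C ] ∃[ N ] (∀ n → .{{_ : NonZero n}} → n > N → a n ≤ C * b n)

ℚ≤⇒ℕ≤ : ∀ a b p q d → ℚ.∣ fromℕ a ∣ ℚ.≤ ℚ.mkℚᵘ (+ p) q ℚ.* ℚ.∣ + b ℚ./ suc d ∣ → a * suc d ≤ p * b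
ℚ≤⇒ℕ≤ a b p q d le = begin
  a * suc d           ≤⟨ *-monoʳ-≤ a (m≤n*m (suc d) (suc q)) ⟩
  a * (suc q * suc d) ≤⟨ ℤ.drop‿+≤+ (subst₂ ℤ._≤_ (sym (ℤ.pos-* a _))
                           (trans (ℤ.*-identityʳ _) (sym (ℤ.pos-* p b))) (ℚ.drop-*≤* le)) ⟩
  p * b               ∎
  where open ≤-Reasoning

ℕ≤⇒ℚ≤ : ∀ a b p d → a * suc d ≤ p * b → ℚ.∣ fromℕ a ∣ ℚ.≤ ℚ.mkℚᵘ (+ p) 0 ℚ.* ℚ.∣ + b ℚ./ suc d ∣
ℕ≤⇒ℚ≤ a b p d le = ℚ.*≤* (subst₂ ℤ._≤_
  (trans (ℤ.pos-* a (suc d)) (cong (λ n → + a ℤ.* + n) (sym (+-identityʳ (suc d)))))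
  (trans (ℤ.pos-* p b) (sym (ℤ.*-identityʳ _)))
  (ℤ.+≤+ le))

=O⇒≲ : ∀ (a b : (n : ℕ) → .{{NonZero n}} → ℕ) → (λ n → fromℕ (a n)) =O (λ n → fromℕ (b n)) → a ≲ b
=O⇒≲ a b (ℚ.mkℚᵘ (+ p) q , _ , N , _ , le) =
  p , N , λ n n>N → subst (_≤ p * b n) (*-identityʳ (a n)) (ℚ≤⇒ℕ≤ (a n) (b n) p q 0 (le n n>N))
=O⇒≲ a b (ℚ.mkℚᵘ ℤ.-[1+ _ ] _ , ℚ.*<* () , _)

=O/n⇒≲ : ∀ (a : ℕ → ℕ) (b : (n : ℕ) → .{{NonZero n}} → ℕ) →
  (λ n → fromℕ (a n)) =O (λ n → + b n ℚ./ n) → (λ n → a n * n) ≲ b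
=O/n⇒≲ a b (ℚ.mkℚᵘ (+ p) q , _ , N , _ , le) =
  p , N , λ { (suc d) n>N → ℚ≤⇒ℕ≤ (a (suc d)) (b (suc d)) p q d (le (suc d) n>N) }
=O/n⇒≲ a b (ℚ.mkℚᵘ ℤ.-[1+ _ ] _ , ℚ.*<* () , _)

≲⇒=O/n : ∀ (a : ℕ → ℕ) (b : (n : ℕ) → .{{NonZero n}} → ℕ) →
  (λ n → a n * n) ≲ b → (λ n → fromℕ (a n)) =O (λ n → + b n ℚ./ n)
≲⇒=O/n a b (C , N , le) =
  -- Successors, because `_=O_` asks for positive constants while `_≲_` allows 0.
  ℚ.mkℚᵘ (+ suc C) 0 , ℚ.*<* (ℤ.+<+ (s≤s z≤n)) , suc N , s≤s z≤n ,
  λ { (suc d) n>N → ℕ≤⇒ℚ≤ (a (suc d)) (b (suc d)) (suc C) d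
        (≤-trans (le (suc d) (<⇒≤ n>N)) (*-monoˡ-≤ (b (suc d)) (n≤1+n C))) }

module _ {a b c : (n : ℕ) → .{{NonZero n}} → ℕ} where

  ≲-trans : a ≲ b → b ≲ c → a ≲ c
  ≲-trans (C , N , le) (C′ , N′ , le′) = C * C′ , N + N′ , λ n n>N → begin
    a n              ≤⟨ le n (m+n≤o⇒m≤o (suc N) n>N) ⟩
    C * b n          ≤⟨ *-monoʳ-≤ C (le′ n (≤-trans (s≤s (m≤n+m N′ N)) n>N)) ⟩
    C * (C′ * c n)   ≡⟨ sym (*-assoc C C′ (c n)) ⟩
    C * C′ * c n     ∎
    where open ≤-Reasoning

  ≲-+ : a ≲ c → b ≲ c → (λ n → a n + b n) ≲ c
  ≲-+ (C , N , le) (C′ , N′ , le′) = C + C′ , N + N′ , λ n n>N → begin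
    a n + b n             ≤⟨ +-mono-≤ (le n (m+n≤o⇒m≤o (suc N) n>N)) (le′ n (≤-trans (s≤s (m≤n+m N′ N)) n>N)) ⟩
    C * c n + C′ * c n    ≡⟨ sym (*-distribʳ-+ (c n) C C′) ⟩
    (C + C′) * c n        ∎
    where open ≤-Reasoning

≤⇒≲ : ∀ {a b : (n : ℕ) → .{{NonZero n}} → ℕ} C → (∀ n → .{{_ : NonZero n}} → a n ≤ C * b n) → a ≲ b
≤⇒≲ C le = C , 0 , λ n _ → le n

-- Since e n ≤ C (a n) / n, the summand e n is absorbed by a n for n ≥ 4 C C′.
≲-absorb : ∀ {a b e : (n : ℕ) → .{{NonZero n}} → ℕ} → (∀ n → .{{_ : NonZero n}} → 1 ≤ e n) →
  (λ n → e n * n) ≲ a → a ≲ (λ n → b n + e n + 1) → a ≲ b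
≲-absorb {a} {b} {e} e≥1 (C , N , le) (C′ , N′ , le′) =
  2 * C′ , 4 * (C′ * C) + (N + N′) , λ n n>N →
    let n>N₁ = ≤-trans (s≤s (≤-trans (m≤m+n N N′) (m≤n+m (N + N′) (4 * (C′ * C))))) n>N
        n>N₂ = ≤-trans (s≤s (≤-trans (m≤n+m N′ N) (m≤n+m (N + N′) (4 * (C′ * C))))) n>N
        big  = ≤-trans (m≤m+n (4 * (C′ * C)) (N + N′)) (<⇒≤ n>N)
    in *-cancelˡ-≤ n (+-cancelʳ-≤ (n * a n) (n * a n) (n * (2 * C′ * b n)) (begin
      n * a n + n * a n
        ≤⟨ +-mono-≤ (*-monoʳ-≤ n (le′ n n>N₂)) (*-monoʳ-≤ n (le′ n n>N₂)) ⟩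
      n * (C′ * (b n + e n + 1)) + n * (C′ * (b n + e n + 1))
        ≤⟨ (let e≤ = *-monoʳ-≤ n (*-monoʳ-≤ C′ (+-monoʳ-≤ (b n + e n) (e≥1 n))) in +-mono-≤ e≤ e≤) ⟩
      n * (C′ * (b n + e n + e n)) + n * (C′ * (b n + e n + e n))
        ≡⟨ solve 4 (λ n c b e → n :* (c :* (b :+ e :+ e)) :+ n :* (c :* (b :+ e :+ e)) :=
             n :* (con 2 :* c :* b) :+ con 4 :* c :* (e :* n)) refl n C′ (b n) (e n) ⟩
      n * (2 * C′ * b n) + 4 * C′ * (e n * n)
        ≤⟨ +-monoʳ-≤ (n * (2 * C′ * b n)) (*-monoʳ-≤ (4 * C′) (le n n>N₁)) ⟩
      n * (2 * C′ * b n) + 4 * C′ * (C * a n)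
        ≡⟨ cong (λ x → n * (2 * C′ * b n) + x)
             (solve 3 (λ c d a → con 4 :* c :* (d :* a) := con 4 :* (c :* d) :* a) refl C′ C (a n)) ⟩
      n * (2 * C′ * b n) + 4 * (C′ * C) * a n
        ≤⟨ +-monoʳ-≤ (n * (2 * C′ * b n)) (*-monoˡ-≤ (a n) big) ⟩
      n * (2 * C′ * b n) + n * a n ∎))
  where
  open ≤-Reasoning
  open +-*-Solver

-- Computations with the same results

haltsAfter-unique : ∀ {m} (M : Machine m) {s t c} → HaltsAfter M s c → HaltsAfter M t c → s ≡ t
haltsAfter-unique M {s} {t} (h , before-s) (h′ , before-t) with <-cmp s t
... | tri< s<t _ _ = contradiction (trans (sym h) (before-t s s<t)) λ ()
... | tri≈ _ s≡t _ = s≡t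
... | tri> _ _ t<s = contradiction (trans (sym h′) (before-s t t<s)) λ ()

computes-unique : ∀ {M f g} → M Computes f → M Computes g → ∀ n → .{{_ : NonZero n}} → f n ≡ g n
computes-unique {M} {f} {g} c d n =
  shows-unique (result c n)
    (subst (λ t → R M n t Shows g n) (haltsAfter-unique M (halts d n) (halts c n)) (result d n))
  where open _Computes_

_≐_ : (f g : ℕ → ℕ) → Set
f ≐ g = ∀ n → .{{NonZero n}} → f n ≡ g n

computes-cong : ∀ {M f g} → f ≐ g → M Computes f → M Computes g
computes-cong {M} f≐g c = record
  { time   = C.time
  ; halts  = C.halts
  ; result = λ n → subst (R M n (C.time n) Shows_) (f≐g n) (C.result n)
  }
  where module C = _Computes_ c

optimal-cong : ∀ {M f g} → f ≐ g → IsOptimal M f → IsOptimal M g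
optimal-cong f≐g o = record
  { computes = computes-cong f≐g O.computes
  ; optimal  = λ M c → O.optimal M (computes-cong (λ n → sym (f≐g n)) c)
  }
  where module O = IsOptimal o

turns-cong : ∀ P x b {y z} → y ≡ z → P Turns x To y Within b → P Turns x To z Within b
turns-cong P x b refl t = t

approximation-cong : ∀ {M f g} → f ≐ g → IsApproximation M f → IsApproximation M g
approximation-cong f≐g (P , a) = P , record
  { M*            = M*
  ; isOptimal     = optimal-cong f≐g isOptimal
  ; F             = F
  ; F-bound       = F-bound
  ; r             = r
  ; computes      = computes
  ; final         = λ n → turns-cong P (n , n , r n) (F n) (f≐g n) (final n)
  ; k             = k
  ; r′            = r′
  ; nondecreasing = nondecreasing
  ; during        = during
  ; written       = written
  ; intermediate  = λ n i 1≤i i<n →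
      turns-cong P (n , i , r′ n i) (F i) (f≐g i {{>-nonZero 1≤i}}) (intermediate n i 1≤i i<n)
  }
  where open IsApproximationVia a

-- Approximations

turns-immediately : ∀ (P : Machine 3) n i r {y} b → Machine.halting P (Machine.start P) ≡ true →
  P Turns (n , i , r) To y Within b → r ≡ y
turns-immediately P n i r b h (zero  , _ , _ , shown)        = shows-unique (resultTape-shows r) shown
turns-immediately P n i r b h (suc t , _ , (_ , before) , _) =
  contradiction (trans (sym h) (before 0 (s≤s z≤n))) λ ()

turns-slowly : ∀ (P : Machine 3) n i r {y} b → Machine.halting P (Machine.start P) ≡ false →
  P Turns (n , i , r) To y Within b → 1 ≤ b
turns-slowly P n i r b h (zero  , _ , (h′ , _) , _) = contradiction (trans (sym h) h′) λ ()
turns-slowly P n i r b h (suc t , t<b , _)          = ≤-trans (s≤s z≤n) t<b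

record Conversion (f g : ℕ → ℕ) : Set₁ where
  field
    M*        : Machine 1
    isOptimal : IsOptimal M* g
    P         : Machine 3
    F         : ℕ → ℕ
    F-bound   : (λ n → F n * n) ≲ time (IsOptimal.computes isOptimal)
    converts  : ∀ n → .{{NonZero n}} → P Turns (n , n , f n) To g n Within F n

conversion : ∀ {M f g} → IsETuring M f → IsApproximation M g → Conversion f g
conversion {f = f} {g} e (P , a) = record
  { M*        = A.M*
  ; isOptimal = A.isOptimal
  ; P         = P
  ; F         = A.F
  ; F-bound   = =O/n⇒≲ A.F (time (IsOptimal.computes A.isOptimal)) A.F-bound
  ; converts  = λ n → subst (λ r → P Turns (n , n , r) To g n Within A.F n)
                        (computes-unique A.computes (IsETuring.computes e) n) (A.final n)
  }
  where module A = IsApproximationVia a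

optimal-≲ : ∀ {M M′ f} (o : IsOptimal M f) (c : M′ Computes f) → time (IsOptimal.computes o) ≲ time c
optimal-≲ o c = =O⇒≲ (time (IsOptimal.computes o)) (time c) (IsOptimal.optimal o _ c)

Instant : Machine 3 → Set
Instant P = Machine.halting P (Machine.start P) ≡ true

instant-≐ : ∀ {f g} (c : Conversion f g) → Instant (Conversion.P c) → f ≐ g
instant-≐ {f} c h n = turns-immediately P n n (f n) (F n) h (converts n)
  where open Conversion c

module _ {g h M} (o : IsOptimal M h) (c : Conversion h g) where

  open Conversion c

  private
    module O = IsOptimal o
    module C = _Computes_ O.computes

    K : Machine 1
    K = Composition.machine M P 0F 0F

    converting : ∀ n → .{{_ : NonZero n}} →
      ∃[ t ] (t ≤ 12 * (C.time n + F n + 1) × HaltsAfter K t (K on n) × R K n t Shows g n)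
    converting n = Sequence.sequence M P 0F 0F (n ∷ []) {[]} {h n} {g n} {F n} {C.time n} (inj₁ refl)
      (C.halts n) (C.result n) (converts n)

    converted : K Computes g
    converted = record
      { time   = λ n → proj₁ (converting n)
      ; halts  = λ n → proj₁ (proj₂ (proj₂ (converting n)))
      ; result = λ n → proj₂ (proj₂ (proj₂ (converting n)))
      }

  conversion-≲ : Machine.halting P (Machine.start P) ≡ false → time (IsOptimal.computes isOptimal) ≲ C.time
  conversion-≲ slow =
    ≲-absorb {b = C.time} {e = λ n → F n} (λ n → turns-slowly P n n (h n) (F n) slow (converts n)) F-bound
      (≲-trans {b = time converted} (optimal-≲ isOptimal converted)
        (≤⇒≲ 12 (λ n → proj₁ (proj₂ (converting n)))))

-- M itself approximates h: its results turn into values of g, and the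
-- values g i, which are final results, turn into values of h.
approximation-compose : ∀ {M g h} → IsApproximation M g → Conversion g h → Conversion h g → IsApproximation M h
approximation-compose {M} {g} {h} (P₁ , a) c d
  with Machine.halting (Conversion.P c) (Machine.start (Conversion.P c)) in instant-c
     | Machine.halting (Conversion.P d) (Machine.start (Conversion.P d)) in instant-d
... | true  | _    = approximation-cong (instant-≐ c instant-c) (P₁ , a)
... | false | true = approximation-cong (λ n → sym (instant-≐ d instant-d n)) (P₁ , a)
... | false | false = Composition.machine P₁ C.P 1F 2F , record
  { M*            = C.M*
  ; isOptimal     = C.isOptimal
  ; F             = F
  ; F-bound       = ≲⇒=O/n F Th F-bound
  ; r             = A.r
  ; computes      = A.computes
  ; final         = λ n → turns n n (A.r n) (A.final n)
  ; k             = A.k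
  ; r′            = A.r′
  ; nondecreasing = A.nondecreasing
  ; during        = A.during
  ; written       = A.written
  ; intermediate  = λ n i 1≤i i<n → turns n i {{>-nonZero 1≤i}} (A.r′ n i) (A.intermediate n i 1≤i i<n)
  }
  where
  module A = IsApproximationVia a
  module C = Conversion c
  module D = Conversion d

  Th Tg : (n : ℕ) → .{{NonZero n}} → ℕ
  Th = time (IsOptimal.computes C.isOptimal)
  Tg = time (IsOptimal.computes A.isOptimal)

  F : ℕ → ℕ
  F n = 12 * (A.F n + C.F n + 1)

  turns : ∀ n i → .{{_ : NonZero i}} → ∀ r → P₁ Turns (n , i , r) To g i Within A.F i →
    Composition.machine P₁ C.P 1F 2F Turns (n , i , r) To h i Within F i
  turns n i r (t , t≤F , halts , shows) =
    let t′ , le , halts′ , shows′ = Sequence.sequence P₁ C.P 1F 2F (n ∷ i ∷ r ∷ []) {reverse (♯ ∷ numeral r)} {g i} {h i} {C.F i} {t}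
                                      (inj₂ ((λ ()) , refl)) halts shows (C.converts i)
    in t′ , ≤-trans le (*-monoʳ-≤ 12 (+-monoˡ-≤ 1 (+-monoˡ-≤ (C.F i) t≤F))) , halts′ , shows′

  Tg≲Th : Tg ≲ Th
  Tg≲Th = ≲-trans {b = time (IsOptimal.computes D.isOptimal)}
    (optimal-≲ A.isOptimal (IsOptimal.computes D.isOptimal)) (conversion-≲ C.isOptimal d instant-d)

  F-bound : (λ n → F n * n) ≲ Th
  F-bound = ≲-trans {b = λ n → A.F n * n + C.F n * n + C.F n * n}
    (≤⇒≲ 12 λ n → begin
      12 * (A.F n + C.F n + 1) * n
        ≤⟨ *-monoˡ-≤ n (*-monoʳ-≤ 12 (+-monoʳ-≤ (A.F n + C.F n)
             (turns-slowly C.P n n (g n) (C.F n) instant-c (C.converts n)))) ⟩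
      12 * (A.F n + C.F n + C.F n) * n
        ≡⟨ solve 3 (λ n a c → con 12 :* (a :+ c :+ c) :* n := con 12 :* (a :* n :+ c :* n :+ c :* n)) refl n (A.F n) (C.F n) ⟩
      12 * (A.F n * n + C.F n * n + C.F n * n) ∎)
    (≲-+ {a = λ n → A.F n * n + C.F n * n}
      (≲-+ {a = λ n → A.F n * n} (≲-trans {b = Tg} (=O/n⇒≲ A.F Tg A.F-bound) Tg≲Th) C.F-bound) C.F-bound)
    where
    open ≤-Reasoning
    open +-*-Solver

-- Computational analogy

idle : Machine 3
idle = record
  { work    = 0
  ; State   = Fin 1
  ; size    = 1
  ; finite  = ↔-refl
  ; start   = 0F
  ; halting = λ _ → true
  ; δ       = λ q ss o → q , Vec.map keep ss , (o , stay)
  }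

eTuring-approximation : ∀ {M M* f} → IsETuring M f → IsOptimal M* f → IsApproximation M f
eTuring-approximation {M* = M*} {f} e o = idle , record
  { M*            = M*
  ; isOptimal     = o
  ; F             = λ _ → 0
  ; F-bound       = ≲⇒=O/n (λ _ → 0) (time (IsOptimal.computes o)) (≤⇒≲ 0 (λ n → z≤n))
  ; r             = f
  ; computes      = computes
  ; final         = λ n → idles n n (f n)
  ; k             = k
  ; r′            = λ n i → f i
  ; nondecreasing = λ n i j 1≤i i<j j<n → <⇒≤ (increasing n i j 1≤i i<j j<n)
  ; during        = during
  ; written       = written
  ; intermediate  = λ n i _ _ → idles n i (f i)
  }
  where
  open IsETuring e
  idles : ∀ n i r → idle Turns (n , i , r) To r Within 0
  idles n i r = 0 , z≤n , (refl , λ _ ()) , resultTape-shows r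

CA-refl : ∀ {f} → In𝒞 f → f CA f
CA-refl f∈𝒞 = (Mᵉ , e , a) , (Mᵉ , e , a)
  where
  Mᵉ = proj₁ (In𝒞.efficient f∈𝒞)
  e = IsEfficientETuring.isETuring (proj₂ (In𝒞.efficient f∈𝒞))
  a = eTuring-approximation e (proj₂ (In𝒞.optimal f∈𝒞))

CA-sym : ∀ {f g} → f CA g → g CA f
CA-sym (fg , gf) = gf , fg

CA-trans : ∀ {f g h} → f CA g → g CA h → f CA h
CA-trans ((M₁ , f₁ , g₁) , (M₂ , g₂ , f₂)) ((M₃ , g₃ , h₃) , (M₄ , h₄ , g₄)) =
  (M₁ , f₁ , approximation-compose g₁ (conversion g₃ h₃) (conversion h₄ g₄)) ,
  (M₄ , h₄ , approximation-compose g₄ (conversion g₂ f₂) (conversion f₁ g₁))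

theorem4p5 : IsEquivalence (λ (f g : 𝒞) → proj₁ f CA proj₁ g)
theorem4p5 = record
  { refl  = λ {f} → CA-refl (proj₂ f)
  ; sym   = CA-sym
  ; trans = CA-trans
  }
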